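{- There exists a constant $c$ such that every graph $H$ with $n$ vertices satisfies \[r_{ind}(H) \leq 2^{c n \log n}.\]
   Context: A graph $H$ is an induced subgraph of a graph $G$ if $V(H)\subseteq V(G)$ and two vertices of $H$ are adjacent in $H$ if and only if they are adjacent in $G$. The induced Ramsey number $r_{ind}(H)$ is the smallest natural number $N$ for which there is a graph $G$ on $N$ vertices such that every two-coloring of the edges of $G$ contains an induced subgraph of $G$ isomorphic to $H$ all of whose edges have the same color. Logarithms are to base $2$. -}

module Defs where

open import Data.Nat using (ℕ; _≤_)
open import Data.Fin using (Fin)
open import Data.Bool using (Bool; true; false)
open import Data.Product using (Σ; ∃; ∃-syntax; _×_)
open import Relation.Binary.PropositionalEquality using (_≡_)
open import Function.Definitions using (Injective)

record Graph (n : ℕ) : Set where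
  field
    adj    : Fin n → Fin n → Bool
    sym    : ∀ u v → adj u v ≡ adj v u
    irrefl : ∀ v → adj v v ≡ false
open Graph public

-- A two-colouring of the edges of G: a colour (Bool) for each edge,
-- i.e. for each adjacent pair, independent of the order of the endpoints.
-- (Values on non-adjacent pairs are irrelevant.)
record TwoColouring {N : ℕ} (G : Graph N) : Set where
  field
    col    : Fin N → Fin N → Bool
    colSym : ∀ u v → adj G u v ≡ true → col u v ≡ col v u
open TwoColouring public

record InducedCopy {n N : ℕ} (H : Graph n) (G : Graph N) : Set where
  field
    emb      : Fin n → Fin N
    embInj   : Injective _≡_ _≡_ emb
    embInduced : ∀ i j → adj G (emb i) (emb j) ≡ adj H i j
open InducedCopy public

IndRamseyFor : {n N : ℕ} → Graph n → Graph N → Set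
IndRamseyFor H G =
  (κ : TwoColouring G) →
  Σ (InducedCopy H G) λ f → Σ Bool λ c →
    (∀ i j → adj H i j ≡ true → col κ (emb f i) (emb f j) ≡ c)

-- r_ind(H) ≤ B : some graph G on N ≤ B vertices is induced-Ramsey for H
-- (r_ind(H) is the least such N, so this is exactly "r_ind(H) ≤ B").
IndRamseyAtMost : {n : ℕ} → Graph n → ℕ → Set
IndRamseyAtMost H B = ∃[ N ] (N ≤ B × Σ (Graph N) (IndRamseyFor H))

{-# OPTIONS --safe #-}

-- G is the symplectic graph over 𝔽₂ on N = n^O(n) vertices. By Parseval, for every vertex
-- set Y all but few vertices v have |N(v) ∩ Y| = |Y| / 2 up to an error far below the sizes
-- of all sets that occur. Fix a 2-colouring. If colour c has density at least n^(-O(1))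
-- between any two not too small subsets of a set U, then copies with edges of colour c can be
-- built greedily in U; otherwise there are large A, B in which c is sparse, and, after
-- discarding vertices of high c-degree, structures for half as many vertices in the other
-- colour found in A and in B combine to one for the full number. Since "not too small" for s
-- vertices means relative size n^(-O(s)), and at each step the larger of the two targets is
-- halved, the total loss is only n^(-O(n)).
-- The final embedding is greedy as well: across different sets, the degree in the wrong
-- colour stays a small proportion of each candidate set, because both the set and the wrong
-- neighbourhoods in it are halved almost exactly at each step.

module Submission where

open import Defs hiding (sym)
open import Data.Bool using (Bool; true; false; not; _∧_; _∨_; _xor_; if_then_else_)
import Data.Bool.Properties as Bool
open import Data.Empty using (⊥; ⊥-elim)
open import Data.Fin using (Fin; zero; suc; toℕ; fromℕ<; _↑ˡ_; _↑ʳ_; combine; remQuot)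
import Data.Fin.Properties as Fin
open import Data.Fin.Subset.Properties using (anySubset?)
open import Data.Integer as ℤ using (ℤ; +_)
import Data.Integer.Properties as ℤ
import Data.Integer.Tactic.RingSolver as ℤ-Solver
open import Data.Nat
open import Data.Nat.Properties
import Data.Nat.Tactic.RingSolver as ℕ-Solver
open import Data.Product using (Σ; ∃-syntax; _×_; _,_; proj₁; proj₂)
open import Data.Sum using (_⊎_; inj₁; inj₂; swap)
open import Data.Vec using (lookup; tabulate)
open import Data.Vec.Properties using (lookup∘tabulate)
open import Function using (it)
open import Relation.Binary using (tri<; tri≈; tri>)
open import Relation.Binary.PropositionalEquality hiding ([_])
open import Relation.Nullary using (Dec; yes; no; does; ¬_)
open import Relation.Nullary.Decidable using (_×-dec_; dec-true; dec-false)
open import Algebra.Properties.Semiring.Sum +-*-semiring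
  using (sum; sum-cong-≗; ∑-comm; ∑-distrib-+; *-distribˡ-sum; *-distribʳ-sum)
import Algebra.Properties.Semiring.Sum ℤ.+-*-semiring as ∑ℤ

-- Counting

sum-mono : ∀ {n} {f g : Fin n → ℕ} → (∀ i → f i ≤ g i) → sum f ≤ sum g
sum-mono {zero}  f≤g = z≤n
sum-mono {suc n} f≤g = +-mono-≤ (f≤g zero) (sum-mono (λ i → f≤g (suc i)))

term≤sum : ∀ {n} (f : Fin n → ℕ) i → f i ≤ sum f
term≤sum f zero    = m≤m+n _ _
term≤sum f (suc i) = ≤-trans (term≤sum (λ j → f (suc j)) i) (m≤n+m _ _)

sum-const : ∀ n a → sum {n} (λ _ → a) ≡ n * a
sum-const zero    a = refl
sum-const (suc n) a = cong (λ z → a + z) (sum-const n a)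

sum≤ : ∀ {n} {f : Fin n → ℕ} {a} → (∀ i → f i ≤ a) → sum f ≤ n * a
sum≤ {n} {a = a} f≤a = subst (_ ≤_) (sum-const n a) (sum-mono f≤a)

VSet : ℕ → Set
VSet N = Fin N → Bool

infix  4 _∈_ _∉_ _⊆_
infixr 6 _∩_

_∈_ _∉_ : ∀ {N} → Fin N → VSet N → Set
v ∈ X = X v ≡ true
v ∉ X = X v ≡ false

_⊆_ : ∀ {N} → VSet N → VSet N → Set
X ⊆ Y = ∀ v → v ∈ X → v ∈ Y

_∩_ : ∀ {N} → VSet N → VSet N → VSet N
(X ∩ Y) v = X v ∧ Y v

⟦_⟧ : ∀ {N} {P : Fin N → Set} → (∀ v → Dec (P v)) → VSet N
⟦ P? ⟧ v = does (P? v)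

module _ {N : ℕ} {P : Fin N → Set} (P? : ∀ v → Dec (P v)) where

  ∈⟦⟧ : ∀ {v} → P v → v ∈ ⟦ P? ⟧
  ∈⟦⟧ {v} p = dec-true (P? v) p

  ⟦⟧∋ : ∀ {v} → v ∈ ⟦ P? ⟧ → P v
  ⟦⟧∋ {v} e with P? v
  ... | yes p = p

  ⟦⟧∌ : ∀ {v} → v ∉ ⟦ P? ⟧ → ¬ P v
  ⟦⟧∌ {v} e with P? v
  ... | no ¬p = ¬p

∈∩ : ∀ {N} (X Y : VSet N) {v} → v ∈ X → v ∈ Y → v ∈ X ∩ Y
∈∩ X Y {v} x y rewrite x = y

∩∈ˡ : ∀ {N} (X Y : VSet N) → X ∩ Y ⊆ X
∩∈ˡ X Y v e with X v
... | true = refl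

∩∈ʳ : ∀ {N} (X Y : VSet N) → X ∩ Y ⊆ Y
∩∈ʳ X Y v e with X v
... | true = e

∈-or-∉ : ∀ {N} (X : VSet N) v → v ∈ X ⊎ v ∉ X
∈-or-∉ X v with X v
... | true  = inj₁ refl
... | false = inj₂ refl

[_] : Bool → ℕ
[ true  ] = 1
[ false ] = 0

card : ∀ {N} → VSet N → ℕ
card X = sum (λ v → [ X v ])

card-cong : ∀ {N} {X Y : VSet N} → (∀ v → X v ≡ Y v) → card X ≡ card Y
card-cong e = sum-cong-≗ (λ v → cong [_] (e v))

card≤ : ∀ {N} (X : VSet N) → card X ≤ N
card≤ {N} X = subst (card X ≤_) (*-identityʳ N) (sum≤ λ v → bit (X v))
  where
  bit : ∀ b → [ b ] ≤ 1
  bit true  = ≤-refl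
  bit false = z≤n

-- Only the terms in `Z` are kept. With `a` equal to 1 the same inequality gives monotonicity of
-- `card` and the union bounds below.
markov : ∀ {N} (Z : VSet N) (f : Fin N → ℕ) a → (∀ v → v ∈ Z → a ≤ f v) → card Z * a ≤ sum f
markov Z f a h = subst (_≤ sum f) (sym (*-distribʳ-sum a (λ v → [ Z v ]))) (sum-mono pt)
  where
  pt : ∀ v → [ Z v ] * a ≤ f v
  pt v with Z v in e
  ... | true  = subst (_≤ f v) (sym (+-identityʳ a)) (h v e)
  ... | false = z≤n

card-⊆ : ∀ {N} {X Y : VSet N} → X ⊆ Y → card X ≤ card Y
card-⊆ {X = X} {Y} X⊆Y = subst (_≤ card Y) (*-identityʳ _)
  (markov X _ 1 λ v x → subst (λ b → 1 ≤ [ b ]) (sym (X⊆Y v x)) ≤-refl)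

card-∪ : ∀ {N} {X Y Z : VSet N} → (∀ v → v ∈ X → v ∈ Y ⊎ v ∈ Z) → card X ≤ card Y + card Z
card-∪ {X = X} {Y} {Z} cov = subst₂ _≤_ (*-identityʳ _) (∑-distrib-+ (λ v → [ Y v ]) (λ v → [ Z v ])) (markov X _ 1 pt)
  where
  pt : ∀ v → v ∈ X → 1 ≤ [ Y v ] + [ Z v ]
  pt v x with cov v x
  ... | inj₁ y rewrite y = s≤s z≤n
  ... | inj₂ z rewrite z = m≤n+m 1 [ Y v ]

card-partition : ∀ {N} (X Y : VSet N) → card (X ∩ (λ v → not (Y v))) + card (X ∩ Y) ≡ card X
card-partition X Y = trans (sym (∑-distrib-+ (λ v → [ X v ∧ not (Y v) ]) (λ v → [ X v ∧ Y v ]))) (sum-cong-≗ pt)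
  where
  pt : ∀ v → [ X v ∧ not (Y v) ] + [ X v ∧ Y v ] ≡ [ X v ]
  pt v with X v | Y v
  ... | true  | true  = refl
  ... | true  | false = refl
  ... | false | _     = refl

some? : ∀ {N n} (Y : Fin n → VSet N) v → Dec (∃[ i ] v ∈ Y i)
some? Y v = Fin.any? (λ i → Y i v Bool.≟ true)

⋃ : ∀ {N n} → (Fin n → VSet N) → VSet N
⋃ Y = ⟦ some? Y ⟧

∈⋃ : ∀ {N n} (Y : Fin n → VSet N) {v} i → v ∈ Y i → v ∈ ⋃ Y
∈⋃ Y i y = ∈⟦⟧ (some? Y) (i , y)

∉⋃ : ∀ {N n} (Y : Fin n → VSet N) {v} → v ∉ ⋃ Y → ∀ i → v ∉ Y i
∉⋃ Y {v} e i with ∈-or-∉ (Y i) v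
... | inj₁ y = ⊥-elim (⟦⟧∌ (some? Y) e (i , y))
... | inj₂ y = y

card-⋃ : ∀ {N n} (Y : Fin n → VSet N) → card (⋃ Y) ≤ sum (λ i → card (Y i))
card-⋃ Y = subst₂ _≤_ (*-identityʳ _) (∑-comm (λ v i → [ Y i v ])) (markov (⋃ Y) _ 1 pt)
  where
  pt : ∀ v → v ∈ ⋃ Y → 1 ≤ sum (λ i → [ Y i v ])
  pt v e with ⟦⟧∋ (some? Y) e
  ... | i , y = ≤-trans (subst (λ b → 1 ≤ [ b ]) (sym y) ≤-refl) (term≤sum (λ i → [ Y i v ]) i)

card-⋃≤ : ∀ {N n} (Y : Fin n → VSet N) w {a} → (∀ i → w * card (Y i) ≤ a) → w * card (⋃ Y) ≤ n * a
card-⋃≤ {n = n} Y w {a} h = begin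
  w * card (⋃ Y)                ≤⟨ *-monoʳ-≤ w (card-⋃ Y) ⟩
  w * sum (λ i → card (Y i))    ≡⟨ *-distribˡ-sum w (λ i → card (Y i)) ⟩
  sum (λ i → w * card (Y i))    ≤⟨ sum≤ h ⟩
  n * a                         ∎
  where open ≤-Reasoning

∃-avoiding : ∀ {N} (X Y : VSet N) → card Y < card X → ∃[ v ] (v ∈ X × v ∉ Y)
∃-avoiding X Y lt with Fin.any? (λ v → X v ∧ not (Y v) Bool.≟ true)
... | yes (v , e) = v , ∩∈ˡ X (λ v → not (Y v)) v e , flip (∩∈ʳ X (λ v → not (Y v)) v e)
  where
  flip : ∀ {b} → not b ≡ true → b ≡ false
  flip {false} _ = refl
... | no none = ⊥-elim (<⇒≱ lt (card-⊆ sub))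
  where
  sub : X ⊆ Y
  sub v x with ∈-or-∉ Y v
  ... | inj₁ y = y
  ... | inj₂ y = ⊥-elim (none (v , trans (cong₂ (λ a b → a ∧ not b) x y) refl))

singleton : ∀ {N} → Fin N → VSet N
singleton v = ⟦ Fin._≟ v ⟧

card-singleton : ∀ {N} (v : Fin N) → card (singleton v) ≤ 1
card-singleton {suc N} zero    = s≤s (≤-reflexive (trans (sum-const N 0) (*-zeroʳ N)))
card-singleton {suc N} (suc v) = ≤-trans (≤-reflexive (sum-cong-≗ λ u → cong [_] (refl {x = does (u Fin.≟ v)}))) (card-singleton v)

-- The symplectic graph

module _ {N : ℕ} (G : Graph N) (D : ℕ) where

  nbr : Fin N → VSet N
  nbr v y = adj G v y

  -- Two inequalities replace an absolute value: the deviation bounded by `D` is, up to sign, the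
  -- entry at `v` of the ±1 adjacency matrix applied to the indicator of `Y`.
  Balanced : VSet N → Fin N → Set
  Balanced Y v = 2 * card (Y ∩ nbr v) ≤ card Y + D × card Y ≤ 2 * card (Y ∩ nbr v) + D

  balanced? : ∀ Y v → Dec (Balanced Y v)
  balanced? Y v = (_ ≤? _) ×-dec (_ ≤? _)

  unbalanced : VSet N → VSet N
  unbalanced Y v = not (⟦ balanced? Y ⟧ v)

-- The symmetric 4 × 4 Hadamard matrix with constant diagonal.
hadamard : Fin 4 → Fin 4 → Bool
hadamard zero    _       = false
hadamard (suc i) zero    = false
hadamard (suc i) (suc j) = not (does (i Fin.≟ j))

hadamard-sym : ∀ i j → hadamard i j ≡ hadamard j i
hadamard-sym zero    zero    = refl
hadamard-sym zero    (suc j) = refl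
hadamard-sym (suc i) zero    = refl
hadamard-sym (suc i) (suc j) with i Fin.≟ j | j Fin.≟ i
... | yes _ | yes _ = refl
... | no  _ | no  _ = refl
... | yes p | no ¬q = ⊥-elim (¬q (sym p))
... | no ¬p | yes q = ⊥-elim (¬p (sym q))

hadamard-irrefl : ∀ i → hadamard i i ≡ false
hadamard-irrefl zero = refl
hadamard-irrefl (suc i) with i Fin.≟ i
... | yes _ = refl
... | no ¬p = ⊥-elim (¬p refl)

-- A Kronecker power written additively: `remQuot` splits off the leading base-4 digit, and `xor`
-- multiplies signs, `false` standing for +1.
bit : ∀ m → Fin (4 ^ m) → Fin (4 ^ m) → Bool
bit zero    u v = false
bit (suc m) u v =
  hadamard (proj₁ (remQuot {4} (4 ^ m) u)) (proj₁ (remQuot {4} (4 ^ m) v)) xor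
  bit m (proj₂ (remQuot {4} (4 ^ m) u)) (proj₂ (remQuot {4} (4 ^ m) v))

bit-sym : ∀ m u v → bit m u v ≡ bit m v u
bit-sym zero    u v = refl
bit-sym (suc m) u v = cong₂ _xor_ (hadamard-sym (proj₁ (remQuot {4} (4 ^ m) u)) _) (bit-sym m _ _)

bit-irrefl : ∀ m v → bit m v v ≡ false
bit-irrefl zero    v = refl
bit-irrefl (suc m) v = cong₂ _xor_ (hadamard-irrefl (proj₁ (remQuot {4} (4 ^ m) v))) (bit-irrefl m _)

-- The symplectic graph over 𝔽₂: its ±1 adjacency matrix is a power of a Hadamard matrix.
symplectic : ∀ m → Graph (4 ^ m)
symplectic m = record { adj = bit m ; sym = bit-sym m ; irrefl = bit-irrefl m }

-- Signed sums, Parseval's identity and discrepancy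

signed : Bool → ℤ → ℤ
signed false x = x
signed true  x = ℤ.- x

signed-xor : ∀ a b x → signed (a xor b) x ≡ signed a (signed b x)
signed-xor false b     x = refl
signed-xor true  false x = refl
signed-xor true  true  x = sym (ℤ.neg-involutive x)

∑-signed : ∀ a {n} (f : Fin n → ℤ) → ∑ℤ.sum (λ i → signed a (f i)) ≡ signed a (∑ℤ.sum f)
∑-signed false f = refl
∑-signed true {zero}  f = refl
∑-signed true {suc n} f = trans (cong (λ x → ℤ.- f zero ℤ.+ x) (∑-signed true (λ i → f (suc i))))
  (sym (ℤ.neg-distrib-+ (f zero) _))

∑-++ : ∀ m {n} (f : Fin (m + n) → ℤ) → ∑ℤ.sum f ≡ ∑ℤ.sum (λ i → f (i ↑ˡ n)) ℤ.+ ∑ℤ.sum (λ j → f (m ↑ʳ j))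
∑-++ zero    f = sym (ℤ.+-identityˡ _)
∑-++ (suc m) f = trans (cong (λ x → f zero ℤ.+ x) (∑-++ m (λ i → f (suc i)))) (sym (ℤ.+-assoc (f zero) _ _))

∑-combine : ∀ n k (f : Fin (n * k) → ℤ) → ∑ℤ.sum f ≡ ∑ℤ.sum (λ a → ∑ℤ.sum (λ v → f (combine {n} {k} a v)))
∑-combine zero    k f = refl
∑-combine (suc n) k f = trans (∑-++ k f) (cong (λ x → ∑ℤ.sum (λ v → f (v ↑ˡ (n * k))) ℤ.+ x) (∑-combine n k (λ i → f (k ↑ʳ i))))

-- The Walsh-Hadamard transform.
transform : ∀ m → (Fin (4 ^ m) → ℤ) → Fin (4 ^ m) → ℤ
transform m f v = ∑ℤ.sum (λ y → signed (bit m v y) (f y))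

transform-suc : ∀ m f (a : Fin 4) (v : Fin (4 ^ m)) → transform (suc m) f (combine {4} {4 ^ m} a v) ≡
  ∑ℤ.sum (λ b → signed (hadamard a b) (transform m (λ y → f (combine {4} {4 ^ m} b y)) v))
transform-suc m f a v = trans (∑-combine 4 (4 ^ m) (λ y → signed (bit (suc m) (combine {4} {4 ^ m} a v) y) (f y)))
  (∑ℤ.sum-cong-≗ {x = λ b → ∑ℤ.sum (λ y → signed (bit (suc m) (combine {4} {4 ^ m} a v) (combine {4} {4 ^ m} b y)) (f (combine {4} {4 ^ m} b y)))} inner)
  where
  inner : ∀ b → ∑ℤ.sum (λ y → signed (bit (suc m) (combine {4} {4 ^ m} a v) (combine {4} {4 ^ m} b y)) (f (combine {4} {4 ^ m} b y))) ≡
          signed (hadamard a b) (transform m (λ y → f (combine {4} {4 ^ m} b y)) v)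
  inner b = trans (∑ℤ.sum-cong-≗ pt) (∑-signed (hadamard a b) (λ y → signed (bit m v y) (f (combine {4} {4 ^ m} b y))))
    where
    pt : ∀ y → signed (bit (suc m) (combine {4} {4 ^ m} a v) (combine {4} {4 ^ m} b y)) (f (combine {4} {4 ^ m} b y)) ≡
         signed (hadamard a b) (signed (bit m v y) (f (combine {4} {4 ^ m} b y)))
    pt y = trans (cong (λ c → signed c (f (combine {4} {4 ^ m} b y)))
                   (cong₂ (λ p q → hadamard (proj₁ p) (proj₁ q) xor bit m (proj₂ p) (proj₂ q))
                     (Fin.remQuot-combine {4} {4 ^ m} a v) (Fin.remQuot-combine {4} {4 ^ m} b y)))
                 (signed-xor (hadamard a b) (bit m v y) _)

sq : ℤ → ℤ
sq x = x ℤ.* x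

hadamard-parseval : ∀ (F : Fin 4 → ℤ) →
  ∑ℤ.sum (λ a → sq (∑ℤ.sum (λ b → signed (hadamard a b) (F b)))) ≡ + 4 ℤ.* ∑ℤ.sum (λ b → sq (F b))
hadamard-parseval F = identity (F zero) (F (suc zero)) (F (suc (suc zero))) (F (suc (suc (suc zero))))
  where
  -- Both sides are spelled out exactly as the sums over `Fin 4` reduce, trailing zeros included, so
  -- that the solved identity has the required type by computation.
  identity : ∀ x y z w →
    (x ℤ.+ (y ℤ.+ (z ℤ.+ (w ℤ.+ + 0)))) ℤ.* (x ℤ.+ (y ℤ.+ (z ℤ.+ (w ℤ.+ + 0)))) ℤ.+
    ((x ℤ.+ (y ℤ.+ (ℤ.- z ℤ.+ (ℤ.- w ℤ.+ + 0)))) ℤ.* (x ℤ.+ (y ℤ.+ (ℤ.- z ℤ.+ (ℤ.- w ℤ.+ + 0)))) ℤ.+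
    ((x ℤ.+ (ℤ.- y ℤ.+ (z ℤ.+ (ℤ.- w ℤ.+ + 0)))) ℤ.* (x ℤ.+ (ℤ.- y ℤ.+ (z ℤ.+ (ℤ.- w ℤ.+ + 0)))) ℤ.+
    ((x ℤ.+ (ℤ.- y ℤ.+ (ℤ.- z ℤ.+ (w ℤ.+ + 0)))) ℤ.* (x ℤ.+ (ℤ.- y ℤ.+ (ℤ.- z ℤ.+ (w ℤ.+ + 0)))) ℤ.+ + 0)))
    ≡ + 4 ℤ.* (x ℤ.* x ℤ.+ (y ℤ.* y ℤ.+ (z ℤ.* z ℤ.+ (w ℤ.* w ℤ.+ + 0))))
  identity = ℤ-Solver.solve-∀

-- Induction over the Kronecker factors: for a fixed remainder `v` the 4 × 4 case handles the
-- leading digit, and the induction hypothesis handles each of the four blocks of `f`.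
parseval : ∀ m f → ∑ℤ.sum (λ v → sq (transform m f v)) ≡ + (4 ^ m) ℤ.* ∑ℤ.sum (λ y → sq (f y))
parseval zero f = base (f zero)
  where
  base : ∀ x → (x ℤ.+ + 0) ℤ.* (x ℤ.+ + 0) ℤ.+ + 0 ≡ + 1 ℤ.* (x ℤ.* x ℤ.+ + 0)
  base = ℤ-Solver.solve-∀
parseval (suc m) f = begin
  ∑ℤ.sum (λ v → sq (transform (suc m) f v))
    ≡⟨ ∑-combine 4 (4 ^ m) (λ v → sq (transform (suc m) f v)) ⟩
  ∑ℤ.sum (λ a → ∑ℤ.sum (λ v → sq (transform (suc m) f (combine {4} {4 ^ m} a v))))
    ≡⟨ ∑ℤ.sum-cong-≗ (λ a → ∑ℤ.sum-cong-≗ λ v → cong sq (transform-suc m f a v)) ⟩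
  ∑ℤ.sum (λ a → ∑ℤ.sum (λ v → sq (∑ℤ.sum (λ b → signed (hadamard a b) (T b v)))))
    ≡⟨ ∑ℤ.∑-comm (λ a v → sq (∑ℤ.sum (λ b → signed (hadamard a b) (T b v)))) ⟩
  ∑ℤ.sum (λ v → ∑ℤ.sum (λ a → sq (∑ℤ.sum (λ b → signed (hadamard a b) (T b v)))))
    ≡⟨ ∑ℤ.sum-cong-≗ (λ v → hadamard-parseval (λ b → T b v)) ⟩
  ∑ℤ.sum (λ v → + 4 ℤ.* ∑ℤ.sum (λ b → sq (T b v)))
    ≡⟨ ∑ℤ.*-distribˡ-sum (+ 4) (λ v → ∑ℤ.sum (λ b → sq (T b v))) ⟨
  + 4 ℤ.* ∑ℤ.sum (λ v → ∑ℤ.sum (λ b → sq (T b v)))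
    ≡⟨ cong (λ x → + 4 ℤ.* x) (∑ℤ.∑-comm (λ v b → sq (T b v))) ⟩
  + 4 ℤ.* ∑ℤ.sum (λ b → ∑ℤ.sum (λ v → sq (T b v)))
    ≡⟨ cong (λ x → + 4 ℤ.* x) (∑ℤ.sum-cong-≗ λ b → parseval m (λ y → f (combine {4} {4 ^ m} b y))) ⟩
  + 4 ℤ.* ∑ℤ.sum (λ b → + (4 ^ m) ℤ.* S b)
    ≡⟨ cong (λ x → + 4 ℤ.* x) (∑ℤ.*-distribˡ-sum (+ (4 ^ m)) S) ⟨
  + 4 ℤ.* (+ (4 ^ m) ℤ.* ∑ℤ.sum S)
    ≡⟨ ℤ.*-assoc (+ 4) (+ (4 ^ m)) (∑ℤ.sum S) ⟨
  + 4 ℤ.* + (4 ^ m) ℤ.* ∑ℤ.sum S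
    ≡⟨ cong₂ ℤ._*_ (sym (ℤ.pos-* 4 (4 ^ m))) (sym (∑-combine 4 (4 ^ m) (λ y → sq (f y)))) ⟩
  + (4 ^ suc m) ℤ.* ∑ℤ.sum (λ y → sq (f y)) ∎
  where
  open ≡-Reasoning
  T : Fin 4 → Fin (4 ^ m) → ℤ
  T b = transform m (λ y → f (combine {4} {4 ^ m} b y))
  S : Fin 4 → ℤ
  S b = ∑ℤ.sum (λ y → sq (f (combine {4} {4 ^ m} b y)))

∑-pos : ∀ {n} (f : Fin n → ℕ) → ∑ℤ.sum (λ i → + f i) ≡ + sum f
∑-pos {zero}  f = refl
∑-pos {suc n} f = trans (cong (λ x → + f zero ℤ.+ x) (∑-pos (λ i → f (suc i)))) (sym (ℤ.pos-+ (f zero) _))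

sq-abs : ∀ x → sq x ≡ + (ℤ.∣ x ∣ * ℤ.∣ x ∣)
sq-abs (+ n)      = sym (ℤ.pos-* n n)
sq-abs (ℤ.-[1+ n ]) = refl

module _ (m : ℕ) where

  private
    N = 4 ^ m
    G = symplectic m

  indicator : VSet N → Fin N → ℤ
  indicator Y y = + [ Y y ]

  parseval-indicator : ∀ Y → sum (λ v → ℤ.∣ transform m (indicator Y) v ∣ * ℤ.∣ transform m (indicator Y) v ∣) ≡ N * card Y
  parseval-indicator Y = ℤ.+-injective (begin
    + sum (λ v → ℤ.∣ t v ∣ * ℤ.∣ t v ∣)        ≡⟨ ∑-pos (λ v → ℤ.∣ t v ∣ * ℤ.∣ t v ∣) ⟨
    ∑ℤ.sum (λ v → + (ℤ.∣ t v ∣ * ℤ.∣ t v ∣))   ≡⟨ ∑ℤ.sum-cong-≗ (λ v → sym (sq-abs (t v))) ⟩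
    ∑ℤ.sum (λ v → sq (t v))                   ≡⟨ parseval m (indicator Y) ⟩
    + N ℤ.* ∑ℤ.sum (λ y → sq (indicator Y y)) ≡⟨ cong (λ x → + N ℤ.* x) (∑ℤ.sum-cong-≗ (λ y → bit-sq (Y y))) ⟩
    + N ℤ.* ∑ℤ.sum (indicator Y)              ≡⟨ cong (λ x → + N ℤ.* x) (∑-pos (λ y → [ Y y ])) ⟩
    + N ℤ.* + card Y                          ≡⟨ ℤ.pos-* N (card Y) ⟨
    + (N * card Y)                            ∎)
    where
    open ≡-Reasoning
    t = transform m (indicator Y)
    bit-sq : ∀ b → sq (+ [ b ]) ≡ + [ b ]
    bit-sq true  = refl
    bit-sq false = refl

  transform-indicator : ∀ Y v → transform m (indicator Y) v ℤ.+ + (2 * card (Y ∩ bit m v)) ≡ + card Y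
  transform-indicator Y v = begin
    t ℤ.+ + (2 * card (Y ∩ bit m v))
      ≡⟨ cong (λ x → t ℤ.+ + x) (*-distribˡ-sum 2 (λ y → [ (Y ∩ bit m v) y ])) ⟩
    t ℤ.+ + sum (λ y → 2 * [ (Y ∩ bit m v) y ])
      ≡⟨ cong (λ x → t ℤ.+ x) (∑-pos (λ y → 2 * [ (Y ∩ bit m v) y ])) ⟨
    t ℤ.+ ∑ℤ.sum (λ y → + (2 * [ (Y ∩ bit m v) y ]))
      ≡⟨ ∑ℤ.∑-distrib-+ (λ y → signed (bit m v y) (+ [ Y y ])) (λ y → + (2 * [ (Y ∩ bit m v) y ])) ⟨
    ∑ℤ.sum (λ y → signed (bit m v y) (+ [ Y y ]) ℤ.+ + (2 * [ (Y ∩ bit m v) y ]))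
      ≡⟨ ∑ℤ.sum-cong-≗ (λ y → pt (bit m v y) (Y y)) ⟩
    ∑ℤ.sum (indicator Y)
      ≡⟨ ∑-pos (λ y → [ Y y ]) ⟩
    + card Y ∎
    where
    open ≡-Reasoning
    t = transform m (indicator Y) v
    pt : ∀ b y → signed b (+ [ y ]) ℤ.+ + (2 * [ y ∧ b ]) ≡ + [ y ]
    pt true  true  = refl
    pt true  false = refl
    pt false true  = refl
    pt false false = refl

  small-transform : ∀ {D a b x} → x ℤ.+ + b ≡ + a → ℤ.∣ x ∣ ≤ D → b ≤ a + D × a ≤ b + D
  small-transform {D} {a} {b} {+ n} e n≤D = m≤n⇒m≤n+o D (subst (b ≤_) (ℤ.+-injective e) (m≤n+m b n)) ,
    subst (_≤ b + D) (trans (+-comm b n) (ℤ.+-injective e)) (+-monoʳ-≤ b n≤D)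
  small-transform {D} {a} {b} {ℤ.-[1+ n ]} e n≤D = subst (_≤ a + D) b≡ (+-monoʳ-≤ a n≤D) ,
    m≤n⇒m≤n+o D (subst (a ≤_) b≡ (m≤m+n a (suc n)))
    where
    b≡ : a + suc n ≡ b
    b≡ = ℤ.+-injective (trans (ℤ.pos-+ a (suc n)) (trans (cong (ℤ._+ + suc n) (sym e)) (cancel (+ suc n) (+ b))))
      where
      cancel : ∀ x y → (ℤ.- x ℤ.+ y) ℤ.+ x ≡ y
      cancel = ℤ-Solver.solve-∀

  -- Chebyshev's argument: at an unbalanced vertex the transform has absolute value at least `D`,
  -- while by Parseval the squares add up to only `N * card Y`.
  card-unbalanced : ∀ D Y → card (unbalanced G D Y) * (D * D) ≤ N * N
  card-unbalanced D Y = begin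
    card (unbalanced G D Y) * (D * D)                   ≤⟨ markov (unbalanced G D Y) _ (D * D) large ⟩
    sum (λ v → ℤ.∣ t v ∣ * ℤ.∣ t v ∣)                   ≡⟨ parseval-indicator Y ⟩
    N * card Y                                          ≤⟨ *-monoʳ-≤ N (card≤ Y) ⟩
    N * N                                               ∎
    where
    open ≤-Reasoning
    t = transform m (indicator Y)
    large : ∀ v → v ∈ unbalanced G D Y → D * D ≤ ℤ.∣ t v ∣ * ℤ.∣ t v ∣
    large v e with D ≤? ℤ.∣ t v ∣
    ... | yes le = *-mono-≤ le le
    ... | no  ≰  = ⊥-elim (bad (balanced? G D Y v) e (small-transform {x = t v} (transform-indicator Y v) (<⇒≤ (≰⇒> ≰))))
      where
      bad : ∀ {P : Set} (d : Dec P) → not (does d) ≡ true → ¬ P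
      bad (no ¬p) _ = ¬p

-- Rich and sparse pairs, structures

module Degrees {N : ℕ} (nb : Bool → Fin N → VSet N) where

  deg : Bool → Fin N → VSet N → ℕ
  deg c x Y = card (Y ∩ nb c x)

  edges : Bool → VSet N → VSet N → ℕ
  edges c A B = sum (λ x → [ A x ] * deg c x B)

  edges≥ : ∀ c w {A B Z a} → Z ⊆ A → (∀ x → x ∈ Z → a ≤ w * deg c x B) → card Z * a ≤ w * edges c A B
  edges≥ c w {A} {B} {Z} {a} Z⊆A h = subst (card Z * a ≤_) (sym (*-distribˡ-sum w (λ x → [ A x ] * deg c x B)))
    (markov Z _ a pt)
    where
    pt : ∀ x → x ∈ Z → a ≤ w * ([ A x ] * deg c x B)
    pt x z rewrite Z⊆A x z | +-identityʳ (deg c x B) = h x z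

  edges≤ : ∀ c w {A B a} → (∀ x → x ∈ A → w * deg c x B ≤ a) → w * edges c A B ≤ card A * a
  edges≤ c w {A} {B} {a} h = begin
    w * edges c A B                          ≡⟨ *-distribˡ-sum w (λ x → [ A x ] * deg c x B) ⟩
    sum (λ x → w * ([ A x ] * deg c x B))    ≤⟨ sum-mono pt ⟩
    sum (λ x → [ A x ] * a)                  ≡⟨ *-distribʳ-sum a (λ x → [ A x ]) ⟨
    card A * a                               ∎
    where
    open ≤-Reasoning
    pt : ∀ x → w * ([ A x ] * deg c x B) ≤ [ A x ] * a
    pt x with A x in e
    ... | true rewrite +-identityʳ (deg c x B) | +-identityʳ a = h x e
    ... | false = ≤-reflexive (*-zeroʳ w)

  edges-cong : ∀ c {A A' B B'} → (∀ x → A x ≡ A' x) → (∀ x → B x ≡ B' x) → edges c A B ≡ edges c A' B'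
  edges-cong c {A' = A'} p q = sum-cong-≗ λ x →
    cong₂ (λ a d → [ a ] * d) (p x) (card-cong λ y → cong (_∧ nb c x y) (q y))

  edges-sym : (∀ c x y → nb c x y ≡ nb c y x) → ∀ c A B → edges c A B ≡ edges c B A
  edges-sym nb-sym c A B = begin
    sum (λ x → [ A x ] * sum (λ y → [ B y ∧ nb c x y ]))
      ≡⟨ sum-cong-≗ (λ x → *-distribˡ-sum [ A x ] (λ y → [ B y ∧ nb c x y ])) ⟩
    sum (λ x → sum (λ y → [ A x ] * [ B y ∧ nb c x y ]))
      ≡⟨ ∑-comm (λ x y → [ A x ] * [ B y ∧ nb c x y ]) ⟩
    sum (λ y → sum (λ x → [ A x ] * [ B y ∧ nb c x y ]))
      ≡⟨ sum-cong-≗ (λ y → sum-cong-≗ λ x → trans (cong (λ b → [ A x ] * [ B y ∧ b ]) (nb-sym c x y)) (pt (A x) (B y) (nb c y x))) ⟩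
    sum (λ y → sum (λ x → [ B y ] * [ A x ∧ nb c y x ]))
      ≡⟨ sum-cong-≗ (λ y → *-distribˡ-sum [ B y ] (λ x → [ A x ∧ nb c y x ])) ⟨
    sum (λ y → [ B y ] * sum (λ x → [ A x ∧ nb c y x ])) ∎
    where
    open ≡-Reasoning
    pt : ∀ a b e → [ a ] * [ b ∧ e ] ≡ [ b ] * [ a ∧ e ]
    pt true  true  e = refl
    pt true  false e = refl
    pt false true  e = refl
    pt false false e = refl

  -- A colour is rich in U at scale s if it has density at least 1/R between
  -- any two subsets of U of relative size at least 1/(β Γˢ).
  module Rich (R β Γ : ℕ) where

    Large : ℕ → VSet N → VSet N → Set
    Large s U A = card U ≤ β * Γ ^ s * card A

    Rich : Bool → ℕ → VSet N → Set
    Rich c s U = ∀ A B → A ⊆ U → B ⊆ U → Large s U A → Large s U B → card A * card B ≤ R * edges c A B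

    Sparse : Bool → ℕ → VSet N → VSet N → VSet N → Set
    Sparse c s U A B = (Large s U A × Large s U B) × R * edges c A B < card A * card B

    sparse? : ∀ c s U A B → Dec (Sparse c s U A B)
    sparse? c s U A B = ((_ ≤? _) ×-dec (_ ≤? _)) ×-dec (_ <? _)

    -- Richness quantifies over finitely many pairs of sets, so the dichotomy is decided by search.
    -- Intersecting with `U` makes the search range over subsets of `U` only.
    rich-or-sparse : ∀ c s U → Rich c s U ⊎ ∃[ A ] ∃[ B ] (A ⊆ U × B ⊆ U × Sparse c s U A B)
    rich-or-sparse c s U with anySubset? (λ a → anySubset? (λ b → sparse? c s U (U ∩ lookup a) (U ∩ lookup b)))
    ... | yes (a , b , sp) = inj₂ (U ∩ lookup a , U ∩ lookup b , ∩∈ˡ U (lookup a) , ∩∈ˡ U (lookup b) , sp)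
    ... | no none = inj₁ λ A B A⊆U B⊆U largeA largeB → ≮⇒≥ λ lt →
      let A≗ = restrict A A⊆U
          B≗ = restrict B B⊆U
          cA = card-cong A≗
          cB = card-cong B≗
      in none (tabulate A , tabulate B ,
               (subst (λ n → card U ≤ β * Γ ^ s * n) cA largeA , subst (λ n → card U ≤ β * Γ ^ s * n) cB largeB) ,
               subst₂ _<_ (cong (R *_) (edges-cong c A≗ B≗)) (cong₂ _*_ cA cB) lt)
      where
      -- Pointwise agreement with the tabulated copy suffices, because richness involves the sets
      -- only through `card` and `edges`.
      restrict : ∀ A → A ⊆ U → ∀ v → A v ≡ (U ∩ lookup (tabulate A)) v
      restrict A A⊆U v rewrite lookup∘tabulate A v with A v in e
      ... | true  = sym (trans (cong (_∧ true) (A⊆U v e)) refl)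
      ... | false with U v
      ...   | true  = refl
      ...   | false = refl

    rich-mono : ⦃ _ : NonZero Γ ⦄ → ∀ {c s s' U} → s' ≤ s → Rich c s U → Rich c s' U
    rich-mono {s = s} {s'} {U} s'≤s rich A B A⊆U B⊆U largeA largeB = rich A B A⊆U B⊆U (weaken A largeA) (weaken B largeB)
      where
      weaken : ∀ A → Large s' U A → Large s U A
      weaken A le = ≤-trans le (*-monoˡ-≤ (card A) (*-monoʳ-≤ β (^-monoʳ-≤ Γ s'≤s)))

-- The value of `R` is the one required by `half-light`: each of at most `M` slots may then exclude
-- at most a fraction 1/(2M) of the vertices.
module Structures {N : ℕ} (nb : Bool → Fin N → VSet N) (nb-sym : ∀ c x y → nb c x y ≡ nb c y x)
  (M E R β Γ f : ℕ) ⦃ _ : NonZero M ⦄ ⦃ _ : NonZero E ⦄ ⦃ _ : NonZero β ⦄ ⦃ _ : NonZero Γ ⦄ ⦃ _ : NonZero f ⦄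
  (R≡ : R ≡ 4 * M * E) where

  open Degrees nb
  open Rich R β Γ

  -- Slots 0, …, cap - 1 are grouped into intervals, the one containing slot j starting at st j.
  -- All slots of an interval share one set, in which colour c is rich; across intervals
  -- colour o is sparse from the earlier set to the later one.
  record Structure (c o : Bool) (cap : ℕ) (V : VSet N) : Set where
    field
      U     : ℕ → VSet N
      st    : ℕ → ℕ
      st≤   : ∀ {j} → j < cap → st j ≤ j
      sub   : ∀ {j} → j < cap → U j ⊆ V
      big   : ∀ {j} → j < cap → f ≤ card (U j)
      same  : ∀ {i j} → i < j → j < cap → st j ≤ i → U i ≡ U j × st i ≡ st j × Rich c (j ∸ st j) (U j)
      cross : ∀ {i j} → j < cap → i < st j → ∀ x → x ∈ U i → E * deg o x (U j) ≤ card (U j)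

  open Structure

  widen : ∀ {c o cap V W} → V ⊆ W → Structure c o cap V → Structure c o cap W
  widen V⊆W S = record
    { U = U S ; st = st S ; st≤ = st≤ S ; big = big S ; same = same S ; cross = cross S
    ; sub = λ j< v u → V⊆W v (sub S j< v u) }

  -- A single interval. Slot 0 has no predecessor, so richness starts at slot 1; for `s` equal to 1
  -- only the size of `V` counts, which is the base of the recursion.
  leaf : ∀ {c o V} s → f ≤ card V → (∀ {j} → 0 < j → j < s → Rich c j V) → Structure c o s V
  leaf {V = V} s f≤V rich = record
    { U = λ _ → V ; st = λ _ → 0 ; st≤ = λ _ → z≤n ; sub = λ _ v e → e ; big = λ _ → f≤V
    ; same = λ i<j j<s _ → refl , refl , rich (≤-<-trans z≤n i<j) j<s
    ; cross = λ _ () }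

  append : ∀ {A : Set} (k : ℕ) → (ℕ → A) → (ℕ → A) → ℕ → A
  append k g h i with i <? k
  ... | yes _ = g i
  ... | no  _ = h (i ∸ k)

  append-< : ∀ {A : Set} {k} (g h : ℕ → A) {i} → i < k → append k g h i ≡ g i
  append-< {k = k} g h {i} i<k with i <? k
  ... | yes _ = refl
  ... | no ≮ = ⊥-elim (≮ i<k)

  append-≥ : ∀ {A : Set} k (g h : ℕ → A) i → append k g h (k + i) ≡ h i
  append-≥ k g h i with k + i <? k
  ... | yes lt = ⊥-elim (m+n≮m k i lt)
  ... | no _  = cong h (m+n∸m≡n k i)

  data Position (k : ℕ) : ℕ → Set where
    before : ∀ {i} → i < k → Position k i
    after  : ∀ i → Position k (k + i)

  position : ∀ k i → Position k i
  position k i with i <? k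
  ... | yes i<k = before i<k
  ... | no  i≮k = subst (Position k) (m+[n∸m]≡n (≮⇒≥ i≮k)) (after (i ∸ k))

  module _ {c o cap V} (S T : Structure c o cap V)
    (S-T : ∀ {i j} → i < cap → j < cap → ∀ x → x ∈ U S i → E * deg o x (U T j) ≤ card (U T j)) where

    private
      U′ : ℕ → VSet N
      U′ = append cap (U S) (U T)
      st′ : ℕ → ℕ
      st′ = append cap (st S) (λ j → cap + st T j)
      U< : ∀ {i} → i < cap → U′ i ≡ U S i
      U< = append-< (U S) (U T)
      U≥ : ∀ i → U′ (cap + i) ≡ U T i
      U≥ = append-≥ cap (U S) (U T)
      st< : ∀ {i} → i < cap → st′ i ≡ st S i
      st< = append-< (st S) _
      st≥ : ∀ i → st′ (cap + i) ≡ cap + st T i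
      st≥ = append-≥ cap (st S) _
      lower : ∀ {i} → cap + i < cap + cap → i < cap
      lower {i} = +-cancelˡ-< cap i cap

    -- The intervals of `T` are shifted behind those of `S`. No interval contains slots of both, so
    -- the one new condition is sparseness from `S` to `T`, supplied by `S-T`.
    concatenate : Structure c o (cap + cap) V
    concatenate = record { U = U′ ; st = st′ ; st≤ = st≤′ ; sub = sub′ ; big = big′ ; same = same′ ; cross = cross′ }
      where
      st≤′ : ∀ {j} → j < cap + cap → st′ j ≤ j
      st≤′ {j} j< with position cap j
      ... | before p rewrite st< p = st≤ S p
      ... | after j′ rewrite st≥ j′ = +-monoʳ-≤ cap (st≤ T (lower j<))
      sub′ : ∀ {j} → j < cap + cap → U′ j ⊆ V
      sub′ {j} j< with position cap j
      ... | before p rewrite U< p = sub S p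
      ... | after j′ rewrite U≥ j′ = sub T (lower j<)
      big′ : ∀ {j} → j < cap + cap → f ≤ card (U′ j)
      big′ {j} j< with position cap j
      ... | before p rewrite U< p = big S p
      ... | after j′ rewrite U≥ j′ = big T (lower j<)
      same′ : ∀ {i j} → i < j → j < cap + cap → st′ j ≤ i → U′ i ≡ U′ j × st′ i ≡ st′ j × Rich c (j ∸ st′ j) (U′ j)
      same′ {i} {j} i<j j< st≤i with position cap j
      ... | before p rewrite st< p | U< p | st< (<-trans i<j p) | U< (<-trans i<j p) = same S i<j p st≤i
      ... | after j′ with position cap i
      -- An interval of `T` starts at `cap` or later and cannot reach back to a slot of `S`.
      ...   | before p = ⊥-elim (<⇒≱ p (m+n≤o⇒m≤o cap (subst (_≤ i) (st≥ j′) st≤i)))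
      ...   | after i′ rewrite st≥ j′ | U≥ j′ | st≥ i′ | U≥ i′ | [m+n]∸[m+o]≡n∸o cap j′ (st T j′)
        with same T (+-cancelˡ-< cap i′ j′ i<j) (lower j<) (+-cancelˡ-≤ cap _ _ st≤i)
      ...     | u , s , r = u , cong (λ z → cap + z) s , r
      cross′ : ∀ {i j} → j < cap + cap → i < st′ j → ∀ x → x ∈ U′ i → E * deg o x (U′ j) ≤ card (U′ j)
      cross′ {i} {j} j< i<st with position cap j
      ... | before p rewrite st< p | U< p | U< (<-trans (<-≤-trans i<st (st≤ S p)) p) = cross S p i<st
      ... | after j′ with position cap i
      ...   | before p rewrite U≥ j′ | U< p = S-T p (lower j<)
      ...   | after i′ rewrite st≥ j′ | U≥ j′ | U≥ i′ = cross T (lower j<) (+-cancelˡ-< cap _ _ i<st)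

  -- Discarding vertices of high degree in a sparse pair

  module _ (c : Bool) where

    low? : ∀ B x → Dec (R * deg c x B ≤ 2 * card B)
    low? B x = R * deg c x B ≤? 2 * card B

    low : VSet N → VSet N → VSet N
    low A B = A ∩ ⟦ low? B ⟧

    low⊆ : ∀ A B → low A B ⊆ A
    low⊆ A B = ∩∈ˡ A ⟦ low? B ⟧

    low-deg : ∀ A B x → x ∈ low A B → R * deg c x B ≤ 2 * card B
    low-deg A B x l = ⟦⟧∋ (low? B) (∩∈ʳ A ⟦ low? B ⟧ x l)

    -- The average `c`-degree from `A` into `B` is below `card B` / `R`, so fewer than half of the
    -- vertices of `A` exceed twice that value.
    half-low : ∀ A B → R * edges c A B < card A * card B → card A ≤ 2 * card (low A B)
    half-low A B sparse = +-cancelʳ-≤ (card A) _ _ (begin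
      card A + card A              ≡⟨ cong (λ z → card A + z) (+-identityʳ (card A)) ⟨
      2 * card A                   ≤⟨ *-monoʳ-≤ 2 (≤-reflexive (sym (card-partition A good))) ⟩
      2 * (card Z + card (low A B)) ≡⟨ trans (*-distribˡ-+ 2 (card Z) _) (+-comm (2 * card Z) _) ⟩
      2 * card (low A B) + 2 * card Z ≤⟨ +-monoʳ-≤ (2 * card (low A B)) (<⇒≤ 2Z<A) ⟩
      2 * card (low A B) + card A  ∎)
      where
      open ≤-Reasoning
      good Z : VSet N
      good = ⟦ low? B ⟧
      Z = A ∩ (λ v → not (good v))
      heavy : ∀ x → x ∈ Z → 2 * card B ≤ R * deg c x B
      heavy x z = <⇒≤ (≰⇒> (⟦⟧∌ (low? B) (unnot (∩∈ʳ A (λ v → not (good v)) x z))))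
        where
        unnot : ∀ {b} → not b ≡ true → b ≡ false
        unnot {false} _ = refl
      2Z<A : 2 * card Z < card A
      2Z<A = *-cancelʳ-< (card B) _ _ (begin-strict
        2 * card Z * card B   ≡⟨ trans (cong (_* card B) (*-comm 2 (card Z))) (*-assoc (card Z) 2 (card B)) ⟩
        card Z * (2 * card B) ≤⟨ edges≥ c R (∩∈ˡ A (λ v → not (good v))) heavy ⟩
        R * edges c A B       <⟨ sparse ⟩
        card A * card B       ∎)

    module _ (B : VSet N) {cap : ℕ} (U : Fin cap → VSet N) where

      heavy? : ∀ j y → Dec (card (U j) < E * deg c y (U j))
      heavy? j y = card (U j) <? E * deg c y (U j)

      heavy : Fin cap → VSet N
      heavy j = B ∩ ⟦ heavy? j ⟧

      light : VSet N
      light = B ∩ (λ y → not (⋃ heavy y))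

      light⊆ : light ⊆ B
      light⊆ = ∩∈ˡ B (λ y → not (⋃ heavy y))

      light-deg : ∀ j y → y ∈ light → E * deg c y (U j) ≤ card (U j)
      light-deg j y l = ≮⇒≥ λ lt → absurd
        (∈⋃ heavy j (∈∩ B ⟦ heavy? j ⟧ (∩∈ˡ B (λ y → not (⋃ heavy y)) y l) (∈⟦⟧ (heavy? j) lt)))
        (∩∈ʳ B (λ y → not (⋃ heavy y)) y l)
        where
        absurd : ∀ {b} → b ≡ true → not b ≡ true → ⊥
        absurd {true} _ ()

      -- The edges between `heavy j` and `U j` are counted from both sides: more than `card (U j)` /
      -- `E` at each heavy vertex, at most 2 `card B` / `R` at each vertex of `U j`. As `R` is 4ME,
      -- each heavy set has at most `card B` / (2M) elements, and all of them together at most half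
      -- of `B`.
      half-light : cap ≤ M → (∀ j → NonZero (card (U j))) → (∀ j x → x ∈ U j → R * deg c x B ≤ 2 * card B) →
        card B ≤ 2 * card light
      half-light cap≤M nz h = +-cancelʳ-≤ (card B) _ _ (begin
        card B + card B                      ≡⟨ cong (λ z → card B + z) (+-identityʳ (card B)) ⟨
        2 * card B                           ≡⟨ cong (2 *_) (card-partition B (⋃ heavy)) ⟨
        2 * (card light + card (B ∩ ⋃ heavy)) ≡⟨ *-distribˡ-+ 2 (card light) _ ⟩
        2 * card light + 2 * card (B ∩ ⋃ heavy) ≤⟨ +-monoʳ-≤ (2 * card light) (*-monoʳ-≤ 2 (card-⊆ (∩∈ʳ B (⋃ heavy)))) ⟩
        2 * card light + 2 * card (⋃ heavy)  ≤⟨ +-monoʳ-≤ (2 * card light) few ⟩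
        2 * card light + card B              ∎)
        where
        open ≤-Reasoning
        each : ∀ j → 2 * M * card (heavy j) ≤ card B
        each j = *-cancelˡ-≤ E (*-cancelˡ-≤ 2 (*-cancelˡ-≤ (card (U j)) (begin
          u * (2 * (E * (2 * M * k)))     ≡⟨ arrange₁ u E M k ⟩
          4 * M * E * (k * u)             ≡⟨ cong (_* (k * u)) R≡ ⟨
          R * (k * u)                     ≤⟨ *-monoʳ-≤ R (edges≥ c E (∩∈ˡ B ⟦ heavy? j ⟧)
                                              (λ y e → <⇒≤ (⟦⟧∋ (heavy? j) (∩∈ʳ B ⟦ heavy? j ⟧ y e)))) ⟩
          R * (E * edges c B (U j))       ≡⟨ cong (λ e → R * (E * e)) (edges-sym nb-sym c B (U j)) ⟩
          R * (E * edges c (U j) B)       ≡⟨ arrange₂ R E (edges c (U j) B) ⟩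
          E * (R * edges c (U j) B)       ≤⟨ *-monoʳ-≤ E (edges≤ c R (h j)) ⟩
          E * (u * (2 * card B))          ≡⟨ arrange₃ E u (card B) ⟩
          u * (2 * (E * card B))          ∎)))
          where
          instance
            _ = nz j
          u = card (U j)
          k = card (heavy j)
          arrange₁ : ∀ u e m k → u * (2 * (e * (2 * m * k))) ≡ 4 * m * e * (k * u)
          arrange₁ = ℕ-Solver.solve-∀
          arrange₂ : ∀ r e x → r * (e * x) ≡ e * (r * x)
          arrange₂ = ℕ-Solver.solve-∀
          arrange₃ : ∀ e u b → e * (u * (2 * b)) ≡ u * (2 * (e * b))
          arrange₃ = ℕ-Solver.solve-∀
        few : 2 * card (⋃ heavy) ≤ card B
        few = *-cancelˡ-≤ M (begin
          M * (2 * card (⋃ heavy)) ≡⟨ trans (sym (*-assoc M 2 _)) (cong (_* card (⋃ heavy)) (*-comm M 2)) ⟩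
          2 * M * card (⋃ heavy)   ≤⟨ card-⋃≤ heavy (2 * M) each ⟩
          cap * card B             ≤⟨ *-monoˡ-≤ (card B) cap≤M ⟩
          M * card B               ∎)

  -- The recursion on the two targets

  -- A potential for the recursion. The exponent `p + q` pays a factor `2 * β` per step. Halving the
  -- larger target lowers the exponent of `Γ` by that target, which is at least the scale `2 ^ p` at
  -- which richness failed.
  size : ℕ → ℕ → ℕ
  size p q = f * ((2 * β) ^ (p + q) * Γ ^ (2 * (2 ^ p + 2 ^ q)))

  f≤size : ∀ p q → f ≤ size p q
  f≤size p q = m≤m*n f ((2 * β) ^ (p + q) * Γ ^ (2 * (2 ^ p + 2 ^ q)))
    ⦃ m*n≢0 _ _ ⦃ m^n≢0 (2 * β) (p + q) ⦃ m*n≢0 2 β ⦄ ⦄ ⦃ m^n≢0 Γ (2 * (2 ^ p + 2 ^ q)) ⦄ ⦄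

  size-comm : ∀ p q → size p q ≡ size q p
  size-comm p q = cong₂ (λ a b → f * ((2 * β) ^ a * Γ ^ (2 * b))) (+-comm p q) (+-comm (2 ^ p) (2 ^ q))

  -- The loss is `β * Γ ^ (2 ^ p)` for passing to one side of the sparse pair and 2 for the
  -- discarded vertices.
  size-step : ∀ p q → p ≤ suc q → ∀ {v a a₀} → size p (suc q) ≤ v → v ≤ β * Γ ^ (2 ^ p) * a → a ≤ 2 * a₀ → size p q ≤ a₀
  size-step p q p≤ {v} {a} {a₀} v≥ a≥ a₀≥ = *-cancelˡ-≤ (2 * β * Γ ^ (2 ^ p)) ⦃ m*n≢0 _ _ ⦃ m*n≢0 2 β ⦄ ⦃ m^n≢0 Γ (2 ^ p) ⦄ ⦄ (begin
    2 * β * Γ ^ (2 ^ p) * size p q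
      ≡⟨ arrange (2 * β) (Γ ^ (2 ^ p)) f ((2 * β) ^ (p + q)) (Γ ^ (2 * (2 ^ p + 2 ^ q))) ⟩
    f * (2 * β * (2 * β) ^ (p + q) * (Γ ^ (2 ^ p) * Γ ^ (2 * (2 ^ p + 2 ^ q))))
      ≡⟨ cong₂ (λ x y → f * ((2 * β) ^ x * y)) (sym (+-suc p q)) (sym (^-distribˡ-+-* Γ (2 ^ p) (2 * (2 ^ p + 2 ^ q)))) ⟩
    f * ((2 * β) ^ (p + suc q) * Γ ^ (2 ^ p + 2 * (2 ^ p + 2 ^ q)))
      ≤⟨ *-monoʳ-≤ f (*-monoʳ-≤ ((2 * β) ^ (p + suc q)) (^-monoʳ-≤ Γ exponent)) ⟩
    size p (suc q)                 ≤⟨ v≥ ⟩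
    v                              ≤⟨ a≥ ⟩
    β * Γ ^ (2 ^ p) * a            ≤⟨ *-monoʳ-≤ (β * Γ ^ (2 ^ p)) a₀≥ ⟩
    β * Γ ^ (2 ^ p) * (2 * a₀)     ≡⟨ arrange′ β (Γ ^ (2 ^ p)) a₀ ⟩
    2 * β * Γ ^ (2 ^ p) * a₀       ∎)
    where
    open ≤-Reasoning
    arrange : ∀ b g f x y → b * g * (f * (x * y)) ≡ f * (b * x * (g * y))
    arrange = ℕ-Solver.solve-∀
    arrange′ : ∀ b g a → b * g * (2 * a) ≡ 2 * b * g * a
    arrange′ = ℕ-Solver.solve-∀
    exponent : 2 ^ p + 2 * (2 ^ p + 2 ^ q) ≤ 2 * (2 ^ p + 2 ^ suc q)
    exponent = begin
      2 ^ p + 2 * (2 ^ p + 2 ^ q)     ≤⟨ +-monoˡ-≤ (2 * (2 ^ p + 2 ^ q)) (^-monoʳ-≤ 2 p≤) ⟩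
      2 ^ suc q + 2 * (2 ^ p + 2 ^ q) ≡⟨ arrange″ (2 ^ p) (2 ^ q) ⟩
      2 * (2 ^ p + 2 ^ suc q)         ∎
      where
      arrange″ : ∀ x y → 2 * y + 2 * (x + y) ≡ 2 * (x + 2 * y)
      arrange″ = ℕ-Solver.solve-∀

  Outcome : Bool → Bool → ℕ → ℕ → VSet N → Set
  Outcome c o p q V = Structure c o (2 ^ p) V ⊎ Structure o c (2 ^ q) V

  -- The side `A` comes first, since the vertices kept in `B` must have low degree into the sets
  -- actually found in `A`. Sparseness thus points from `B` to `A`, and `T`, though found first, is
  -- placed last.
  split : ∀ c o p q → p ≤ suc q → 2 ^ q ≤ M →
    (∀ V → size p q ≤ card V → Outcome c o p q V) →
    ∀ V → size p (suc q) ≤ card V → Outcome c o p (suc q) V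
  split c o p q p≤ q≤M recurse V V≥ with rich-or-sparse c (2 ^ p) V
  ... | inj₁ rich = inj₁ (leaf (2 ^ p) (≤-trans (f≤size p (suc q)) V≥) (λ _ j< → rich-mono (<⇒≤ j<) rich))
  ... | inj₂ (A , B , A⊆V , B⊆V , (largeA , largeB) , sparse)
    with recurse (low c A B) (size-step p q p≤ V≥ largeA (half-low c A B sparse))
  ...   | inj₁ S = inj₁ (widen (λ v e → A⊆V v (low⊆ c A B v e)) S)
  ...   | inj₂ T
    with recurse (light c B (λ (j : Fin (2 ^ q)) → U T (toℕ j)))
           (size-step p q p≤ V≥ largeB
             (half-light c B (λ (j : Fin (2 ^ q)) → U T (toℕ j)) q≤M
               (λ j → >-nonZero (<-≤-trans (>-nonZero⁻¹ f) (big T (Fin.toℕ<n j))))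
               (λ j x u → low-deg c A B x (sub T (Fin.toℕ<n j) x u))))
  ...     | inj₁ S = inj₁ (widen (λ v e → B⊆V v (light⊆ c B (λ (j : Fin (2 ^ q)) → U T (toℕ j)) v e)) S)
  ...     | inj₂ S = inj₂ (subst (λ n → Structure o c n V) (cong (λ z → 2 ^ q + z) (sym (+-identityʳ (2 ^ q))))
              (concatenate (widen (λ v e → B⊆V v (light⊆ c B (λ (j : Fin (2 ^ q)) → U T (toℕ j)) v e)) S) (widen (λ v e → A⊆V v (low⊆ c A B v e)) T) S-T))
    where
    S-T : ∀ {i j} → i < 2 ^ q → j < 2 ^ q → ∀ x → x ∈ U S i → E * deg c x (U T j) ≤ card (U T j)
    S-T {i} {j} i< j< x u = subst (λ k → E * deg c x (U T k) ≤ card (U T k)) (Fin.toℕ-fromℕ< j<)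
      (light-deg c B (λ (j : Fin (2 ^ q)) → U T (toℕ j)) (fromℕ< j<) x (sub S i< x u))

  structure : ∀ c o p q → 2 ^ p ≤ M → 2 ^ q ≤ M → ∀ V → size p q ≤ card V → Outcome c o p q V
  structure c o zero q _ _ V V≥ = inj₁ (leaf 1 (≤-trans (f≤size 0 q) V≥) λ { {suc j} _ (s≤s ()) })
  structure c o (suc p) zero _ _ V V≥ = inj₂ (leaf 1 (≤-trans (f≤size (suc p) 0) V≥) λ { {suc j} _ (s≤s ()) })
  structure c o (suc p) (suc q) p≤M q≤M V V≥ with ≤-total (suc p) (suc q)
  ... | inj₁ p≤q = split c o (suc p) q p≤q (≤-trans (^-monoʳ-≤ 2 (n≤1+n q)) q≤M)
                     (structure c o (suc p) q p≤M (≤-trans (^-monoʳ-≤ 2 (n≤1+n q)) q≤M)) V V≥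
  -- Exchanging the two colours reduces a larger first target to `split`.
  ... | inj₂ q≤p = swap (split o c (suc q) p q≤p p′≤M
                     (λ W W≥ → swap (structure c o p (suc q) p′≤M q≤M W (subst (_≤ card W) (size-comm (suc q) p) W≥)))
                     V (subst (_≤ card V) (size-comm (suc p) (suc q)) V≥))
    where
    p′≤M : 2 ^ p ≤ M
    p′≤M = ≤-trans (^-monoʳ-≤ 2 (n≤1+n p)) p≤M

-- The greedy embedding

-- Adjacency is included because `col` need not be symmetric off the edges.
coloured : ∀ {N} {G : Graph N} → TwoColouring G → Bool → Fin N → VSet N
coloured {G = G} κ c x y = adj G x y ∧ does (col κ x y Bool.≟ c)

coloured-sym : ∀ {N} {G : Graph N} (κ : TwoColouring G) c x y → coloured κ c x y ≡ coloured κ c y x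
coloured-sym {G = G} κ c x y with adj G x y in e | Graph.sym G x y
... | true  | yx rewrite sym yx = cong (λ b → does (b Bool.≟ c)) (colSym κ x y e)
... | false | yx rewrite sym yx = refl

-- For `false` the set contains `v` itself, so distinctness of the chosen vertices has to be secured
-- by deletion.
pattern-set : ∀ {N} → Graph N → Bool → Fin N → VSet N
pattern-set G true  v y = adj G v y
pattern-set G false v y = not (adj G v y)

-- Taking complements in `Y` only changes the sign of the deviation from one half.
balanced-pattern : ∀ {N} (G : Graph N) D h {v} Y → Balanced G D Y v →
  2 * card (Y ∩ pattern-set G h v) ≤ card Y + D × card Y ≤ 2 * card (Y ∩ pattern-set G h v) + D
balanced-pattern G D true  Y b = b
balanced-pattern G D false {v} Y (u , l) = complement (card (Y ∩ pattern-set G false v)) (card (Y ∩ adj G v)) (card Y) (card-partition Y (adj G v)) u l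
  where
  open ≤-Reasoning
  complement : ∀ a b y → a + b ≡ y → 2 * b ≤ y + D → y ≤ 2 * b + D → 2 * a ≤ y + D × y ≤ 2 * a + D
  complement a b y refl p q =
    +-cancelʳ-≤ (a + b) _ _ (+-cancelʳ-≤ (2 * b) _ _ (begin
      2 * a + (a + b) + 2 * b          ≡⟨ e₁ a b ⟩
      2 * (a + b) + (a + b)            ≤⟨ +-monoʳ-≤ (2 * (a + b)) q ⟩
      2 * (a + b) + (2 * b + D)        ≡⟨ e₂ (a + b) (2 * b) D ⟩
      a + b + D + (a + b) + 2 * b      ∎)) ,
    +-cancelʳ-≤ (2 * b) _ _ (begin
      a + b + 2 * b                    ≤⟨ +-monoʳ-≤ (a + b) p ⟩
      a + b + (a + b + D)              ≡⟨ e₃ a b D ⟩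
      2 * a + D + 2 * b                ∎)
    where
    e₁ : ∀ a b → 2 * a + (a + b) + 2 * b ≡ 2 * (a + b) + (a + b)
    e₁ = ℕ-Solver.solve-∀
    e₂ : ∀ a b d → 2 * a + (b + d) ≡ a + d + a + b
    e₂ = ℕ-Solver.solve-∀
    e₃ : ∀ a b d → a + b + (a + b + d) ≡ 2 * a + d + 2 * b
    e₃ = ℕ-Solver.solve-∀

∉-complement : ∀ {b} → not b ≡ true → b ≡ false
∉-complement {false} _ = refl

-- `E` keeps `M` losses of 2/`E` within a quarter; `α` is then twice the pure halving loss; `β` adds
-- the factor `4 * M` for poor sets; `Γ` is the loss per step inside an open interval. `f` leaves
-- `W * D` vertices in each candidate set, and `W` absorbs the multiples of `D` charged against it.
module Embedding {N n : ℕ} (G : Graph N) (H : Graph n) (κ : TwoColouring G) (c o : Bool)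
  (c-or-o : ∀ b → b ≡ c ⊎ b ≡ o)
  (M D B E R α β Γ W f : ℕ)
  ⦃ _ : NonZero M ⦄ ⦃ _ : NonZero E ⦄ ⦃ _ : NonZero β ⦄ ⦃ _ : NonZero Γ ⦄ ⦃ _ : NonZero f ⦄
  ⦃ _ : NonZero D ⦄ ⦃ _ : NonZero α ⦄ ⦃ _ : NonZero W ⦄
  (R≡ : R ≡ 4 * M * E) (E≡ : E ≡ 8 * M) (α≡ : α ≡ 2 * 2 ^ M) (β≡ : β ≡ 4 * M * α) (Γ≡ : Γ ≡ 2 * R)
  (W≡ : W ≡ 2 * (R * (M + 2))) (f≡ : f ≡ α * Γ ^ M * (W * D))
  (card-unb : ∀ Y → card (unbalanced G D Y) ≤ B) (B≤D : B ≤ D) (NB≤DD : N * B ≤ D * D)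
  where

  nb : Bool → Fin N → VSet N
  nb = coloured κ

  open Degrees nb
  open Rich R β Γ
  open Structures nb (coloured-sym κ) M E R β Γ f R≡
  open Structure

  private
    2≤R : 2 ≤ R
    2≤R = ≤-trans (≤-trans (s≤s (s≤s z≤n)) (m≤m*n 4 (M * E) ⦃ m*n≢0 M E ⦄)) (≤-reflexive (trans (sym (*-assoc 4 M E)) (sym R≡)))
    4ME≤W : 4 * (M * E) ≤ W
    4ME≤W = begin
      4 * (M * E)          ≡⟨ trans (sym (*-assoc 4 M E)) (sym R≡) ⟩
      R                    ≤⟨ m≤m*n R (M + 2) ⦃ >-nonZero (m≤n⇒m≤o+n M (s≤s z≤n)) ⦄ ⟩
      R * (M + 2)          ≤⟨ m≤n*m _ 2 ⟩
      2 * (R * (M + 2))    ≡⟨ W≡ ⟨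
      W                    ∎
      where open ≤-Reasoning
    4E≤W : 4 * E ≤ W
    4E≤W = ≤-trans (*-monoʳ-≤ 4 (m≤n*m E M)) 4ME≤W
    8MM≤W : 8 * M * M ≤ W
    8MM≤W = begin
      8 * M * M            ≡⟨ cong (_* M) E≡ ⟨
      E * M                ≡⟨ *-comm E M ⟩
      M * E                ≤⟨ m≤n*m (M * E) 4 ⟩
      4 * (M * E)          ≤⟨ 4ME≤W ⟩
      W                    ∎
      where open ≤-Reasoning

  module _ {V : VSet N} (S : Structure c o M V) (n≤M : n ≤ M) where

    u : Fin n → VSet N
    u j = U S (toℕ j)

    s : Fin n → ℕ
    s j = st S (toℕ j)

    <M : (j : Fin n) → toℕ j < M
    <M j = <-≤-trans (Fin.toℕ<n j) n≤M

    -- Candidate sets after t steps. While the interval of j has not begun (fresh), X j is halved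
    -- at each step up to losses that stay below a fixed proportion; from then on (opened) each
    -- step costs a factor Γ. The additive D-terms come from the discrepancy of G.
    record State (t : ℕ) (X : Fin n → VSet N) : Set where
      field
        inside : ∀ {j} → t ≤ toℕ j → X j ⊆ u j
        fresh  : ∀ {j} → t ≤ toℕ j → t ≤ s j →
          E * card (u j) ≤ E * (2 ^ t * card (X j)) + 2 * t * card (u j) + E * E * (2 ^ suc t * D)
        opened : ∀ {j} → t ≤ toℕ j → s j ≤ t → card (u j) ≤ α * Γ ^ (t ∸ s j) * card (X j)
        spread : ∀ {i j} → t ≤ toℕ i → toℕ i < s j → ∀ x → x ∈ X i →
          E * (2 ^ t * deg o x (X j)) ≤ card (u j) + E * (2 ^ t * D)

    open State

    u-big : ∀ j → f ≤ card (u j)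
    u-big j = big S (<M j)

    -- The proportional losses take at most a quarter of `k`, as `E` is 8M, and the discrepancy term
    -- another quarter, as `f` is large. The remaining half accounts for the 2 in `α`.
    fresh⇒ : ∀ {t k x} → t ≤ M → f ≤ k →
      E * k ≤ E * (2 ^ t * x) + 2 * t * k + E * E * (2 ^ suc t * D) → k ≤ α * x
    fresh⇒ {t} {k} {x} t≤M f≤k h = *-cancelˡ-≤ (2 * E) ⦃ m*n≢0 2 E ⦄ (+-cancelʳ-≤ (2 * (E * k)) _ _ (begin
      2 * E * k + 2 * (E * k)                                        ≡⟨ e₀ E k ⟩
      4 * (E * k)                                                    ≤⟨ *-monoʳ-≤ 4 h ⟩
      4 * (E * (2 ^ t * x) + 2 * t * k + E * E * (2 ^ suc t * D))    ≡⟨ e₁ E (2 ^ t) x t k D ⟩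
      4 * E * (2 ^ t * x) + 8 * t * k + E * (2 * 2 ^ t * (4 * E * D))
        ≤⟨ +-mono-≤ (+-mono-≤ (*-monoʳ-≤ (4 * E) (*-monoˡ-≤ x 2^t≤)) (*-monoˡ-≤ k 8t≤E))
                    (*-monoʳ-≤ E (≤-trans tail≤f f≤k)) ⟩
      4 * E * (2 ^ M * x) + E * k + E * k                            ≡⟨ e₂ E (2 ^ M) x k ⟩
      2 * E * (2 * 2 ^ M * x) + 2 * (E * k)                          ≡⟨ cong (λ a → 2 * E * (a * x) + 2 * (E * k)) α≡ ⟨
      2 * E * (α * x) + 2 * (E * k)                                  ∎))
      where
      open ≤-Reasoning
      2^t≤ : 2 ^ t ≤ 2 ^ M
      2^t≤ = ^-monoʳ-≤ 2 t≤M
      8t≤E : 8 * t ≤ E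
      8t≤E = subst (8 * t ≤_) (sym E≡) (*-monoʳ-≤ 8 t≤M)
      tail≤f : 2 * 2 ^ t * (4 * E * D) ≤ f
      tail≤f = begin
        2 * 2 ^ t * (4 * E * D)   ≤⟨ *-mono-≤ (*-monoʳ-≤ 2 2^t≤) (*-monoˡ-≤ D 4E≤W) ⟩
        2 * 2 ^ M * (W * D)       ≡⟨ cong (_* (W * D)) α≡ ⟨
        α * (W * D)               ≤⟨ *-monoˡ-≤ (W * D) (m≤m*n α (Γ ^ M) ⦃ m^n≢0 Γ M ⦄) ⟩
        α * Γ ^ M * (W * D)       ≡⟨ f≡ ⟨
        f                         ∎
      e₀ : ∀ e k → 2 * e * k + 2 * (e * k) ≡ 4 * (e * k)
      e₀ = ℕ-Solver.solve-∀
      e₁ : ∀ e p x t k d → 4 * (e * (p * x) + 2 * t * k + e * e * (2 * p * d)) ≡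
           4 * e * (p * x) + 8 * t * k + e * (2 * p * (4 * e * d))
      e₁ = ℕ-Solver.solve-∀
      e₂ : ∀ e p x k → 4 * e * (p * x) + e * k + e * k ≡ 2 * e * (2 * p * x) + 2 * (e * k)
      e₂ = ℕ-Solver.solve-∀

    opened-bound : ∀ {t X} → State t X → t ≤ M → ∀ {j} → t ≤ toℕ j →
      card (u j) ≤ α * Γ ^ (t ∸ s j) * card (X j)
    opened-bound {t} {X} σ t≤M {j} t≤j with ≤-total t (s j)
    ... | inj₂ s≤t = opened σ t≤j s≤t
    ... | inj₁ t≤s rewrite m≤n⇒m∸n≡0 t≤s | *-identityʳ α = fresh⇒ t≤M (u-big j) (fresh σ t≤j t≤s)

    X-big : ∀ {t X} → State t X → t ≤ M → ∀ {j} → t ≤ toℕ j → W * D ≤ card (X j)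
    X-big {t} {X} σ t≤M {j} t≤j = *-cancelˡ-≤ (α * Γ ^ M) ⦃ m*n≢0 α (Γ ^ M) ⦃ it ⦄ ⦃ m^n≢0 Γ M ⦄ ⦄ (begin
      α * Γ ^ M * (W * D)               ≡⟨ f≡ ⟨
      f                                 ≤⟨ u-big j ⟩
      card (u j)                        ≤⟨ opened-bound σ t≤M t≤j ⟩
      α * Γ ^ (t ∸ s j) * card (X j)    ≤⟨ *-monoˡ-≤ (card (X j)) (*-monoʳ-≤ α (^-monoʳ-≤ Γ (≤-trans (m∸n≤m t (s j)) t≤M))) ⟩
      α * Γ ^ M * card (X j)            ∎)
      where open ≤-Reasoning

    -- Differs from `pattern-set` only at edges, where the colour is prescribed too: balancedness
    -- controls `pattern-set`, while the copy needs `selected`.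
    selected : Bool → Fin N → VSet N
    selected true  v y = nb c v y
    selected false v y = not (adj G v y)

    selected⊆pattern : ∀ h v → selected h v ⊆ pattern-set G h v
    selected⊆pattern true  v y e = ∩∈ˡ (adj G v) (λ y → does (col κ v y Bool.≟ c)) y e
    selected⊆pattern false v y e = e

    pattern⊆ : ∀ h v y → y ∈ pattern-set G h v → y ∈ selected h v ⊎ y ∈ nb o v
    pattern⊆ false v y e = inj₁ e
    pattern⊆ true  v y e with c-or-o (col κ v y)
    ... | inj₁ p rewrite e = inj₁ (dec-true (col κ v y Bool.≟ c) p)
    ... | inj₂ p rewrite e = inj₂ (dec-true (col κ v y Bool.≟ o) p)

    record Extension (τ : Fin n) (X : Fin n → VSet N) : Set where
      field
        vertex   : Fin N
        vertex∈  : vertex ∈ X τ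
        rest     : Fin n → VSet N
        rest⊆    : ∀ j → rest j ⊆ X j
        joined   : ∀ j → rest j ⊆ selected (adj H τ j) vertex
        vertex∉  : ∀ j y → y ∈ rest j → y ≢ vertex
        state    : State (suc (toℕ τ)) rest

    module Step (τ : Fin n) (X : Fin n → VSet N) (σ : State (toℕ τ) X) where

      t : ℕ
      t = toℕ τ

      t≤M : t ≤ M
      t≤M = <⇒≤ (<M τ)

      -- To maintain `spread` at `x`, the wrong-colour neighbourhood of `x` in `X j` has to be
      -- nearly halved as well. Those `x` for which `v` does not achieve this are deleted; `v` is
      -- rejected if there are more than `D` of them.
      spoiled : Fin n → Fin n → Fin N → VSet N
      spoiled i j v x = X i x ∧ unbalanced G D (X j ∩ nb o x) v

      spoiling? : ∀ i j v → Dec (D < card (spoiled i j v))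
      spoiling? i j v = D <? card (spoiled i j v)

      -- Double counting: each `x` is spoiled by at most `B` vertices `v`, so there are at most
      -- `N * B` such pairs.
      card-spoiling : ∀ i j → card ⟦ spoiling? i j ⟧ ≤ D
      card-spoiling i j = *-cancelʳ-≤ _ _ D (begin
        card ⟦ spoiling? i j ⟧ * D
          ≤⟨ markov ⟦ spoiling? i j ⟧ (λ v → card (spoiled i j v)) D (λ v e → <⇒≤ (⟦⟧∋ (spoiling? i j) e)) ⟩
        sum (λ v → card (spoiled i j v))
          ≡⟨ ∑-comm (λ v x → [ spoiled i j v x ]) ⟩
        sum (λ x → card (λ v → spoiled i j v x))
          ≤⟨ sum≤ (λ x → ≤-trans (card-⊆ (∩∈ʳ (λ _ → X i x) (unbalanced G D (X j ∩ nb o x)))) (card-unb (X j ∩ nb o x))) ⟩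
        N * B   ≤⟨ NB≤DD ⟩
        D * D   ∎)
        where open ≤-Reasoning

      Poor : Fin n → Fin N → Set
      Poor j v = (t < toℕ j × s j ≤ t) × R * deg c v (X j) < card (X j)

      poor? : ∀ j v → Dec (Poor j v)
      poor? j v = ((t <? toℕ j) ×-dec (s j ≤? t)) ×-dec (_ <? _)

      poor : Fin n → VSet N
      poor j = X τ ∩ ⟦ poor? j ⟧

      -- A poor set of size comparable to X τ would contradict richness.
      card-poor : ∀ j → 4 * M * card (poor j) ≤ card (X τ)
      card-poor j = ≮⇒≥ contradictory
        where
        contradictory : ¬ card (X τ) < 4 * M * card (poor j)
        contradictory lt = <⇒≱ too-sparse (rich (poor j) (X j) poor⊆u (inside σ (<⇒≤ t<j)) large-poor large-X)
          where
          open ≤-Reasoning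
          k = card (poor j)
          0<k : 0 < k
          0<k = n≢0⇒n>0 λ e → n≮0 (subst (card (X τ) <_) (trans (cong (4 * M *_) e) (*-zeroʳ (4 * M))) lt)
          -- The position of `j` relative to `t` is recorded only inside `Poor`, so an element is
          -- needed to read it off.
          member : ∃[ v ] (v ∈ poor j × v ∉ (λ _ → false))
          member = ∃-avoiding (poor j) (λ _ → false) (subst (_< k) (sym (trans (sum-const N 0) (*-zeroʳ N))) 0<k)
          conditions : t < toℕ j × s j ≤ t
          conditions = proj₁ (⟦⟧∋ (poor? j) (∩∈ʳ (X τ) ⟦ poor? j ⟧ (proj₁ member) (proj₁ (proj₂ member))))
          t<j = proj₁ conditions
          s≤t = proj₂ conditions
          shared = same S t<j (<M j) s≤t
          rich : Rich c (toℕ j ∸ s j) (u j)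
          rich = proj₂ (proj₂ shared)
          poor⊆u : poor j ⊆ u j
          poor⊆u v e = subst (λ Y → v ∈ Y) (proj₁ shared) (inside σ ≤-refl v (∩∈ˡ (X τ) ⟦ poor? j ⟧ v e))
          enlarge : ∀ {x} → card (u j) ≤ α * Γ ^ (t ∸ s j) * x → ∀ {y} → x ≤ 4 * M * y →
            card (u j) ≤ β * Γ ^ (toℕ j ∸ s j) * y
          enlarge {x} h {y} x≤ = begin
            card (u j)                                   ≤⟨ h ⟩
            α * Γ ^ (t ∸ s j) * x                        ≤⟨ *-mono-≤ (*-monoʳ-≤ α (^-monoʳ-≤ Γ (∸-monoˡ-≤ (s j) (<⇒≤ t<j)))) x≤ ⟩
            α * Γ ^ (toℕ j ∸ s j) * (4 * M * y)          ≡⟨ arrange α (Γ ^ (toℕ j ∸ s j)) M y ⟩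
            4 * M * α * Γ ^ (toℕ j ∸ s j) * y            ≡⟨ cong (λ b → b * Γ ^ (toℕ j ∸ s j) * y) β≡ ⟨
            β * Γ ^ (toℕ j ∸ s j) * y                    ∎
            where
            arrange : ∀ a g m y → a * g * (4 * m * y) ≡ 4 * m * a * g * y
            arrange = ℕ-Solver.solve-∀
          large-poor : Large (toℕ j ∸ s j) (u j) (poor j)
          large-poor = enlarge
            (subst₂ (λ Y r → card Y ≤ α * Γ ^ (t ∸ r) * card (X τ)) (proj₁ shared) (proj₁ (proj₂ shared)) (opened-bound σ t≤M ≤-refl))
            (<⇒≤ lt)
          large-X : Large (toℕ j ∸ s j) (u j) (X j)
          large-X = enlarge (opened σ (<⇒≤ t<j) s≤t) (m≤n*m (card (X j)) (4 * M) ⦃ m*n≢0 4 M ⦄)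
          too-sparse : R * edges c (poor j) (X j) < k * card (X j)
          too-sparse = begin-strict
            -- The strict bound on degrees becomes a weak one with `pred`, which fits `edges≤`;
            -- strictness returns in the next line.
            R * edges c (poor j) (X j)  ≤⟨ edges≤ c R {poor j} {X j} (λ x e → <⇒≤pred (proj₂ (⟦⟧∋ (poor? j) (∩∈ʳ (X τ) ⟦ poor? j ⟧ x e)))) ⟩
            k * pred (card (X j))       <⟨ *-monoʳ-< k ⦃ >-nonZero 0<k ⦄ (pred< (card (X j)) ⦃ >-nonZero positive ⦄) ⟩
            k * card (X j)              ∎
            where
            positive : 0 < card (X j)
            positive = ≤-<-trans z≤n (proj₂ (⟦⟧∋ (poor? j) (∩∈ʳ (X τ) ⟦ poor? j ⟧ (proj₁ member) (proj₁ (proj₂ member)))))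
            pred< : ∀ n ⦃ _ : NonZero n ⦄ → pred n < n
            pred< (suc n) = ≤-refl

      ⋃-small : ∀ w (Y : Fin n → VSet N) {L} → (∀ i → w * M * card (Y i) ≤ L) → w * card (⋃ Y) ≤ L
      ⋃-small w Y {L} h = *-cancelˡ-≤ M (begin
        M * (w * card (⋃ Y))  ≡⟨ trans (sym (*-assoc M w _)) (cong (_* card (⋃ Y)) (*-comm M w)) ⟩
        w * M * card (⋃ Y)    ≤⟨ card-⋃≤ Y (w * M) h ⟩
        n * L                 ≤⟨ *-monoˡ-≤ L n≤M ⟩
        M * L                 ∎)
        where open ≤-Reasoning

      unbalancedSet spoilingSet : Fin n → VSet N
      unbalancedSet j = unbalanced G D (X j)
      spoilingSet j = ⋃ (λ i → ⟦ spoiling? i j ⟧)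

      bad : VSet N
      bad v = ⋃ unbalancedSet v ∨ (⋃ poor v ∨ ⋃ spoilingSet v)

      -- Unbalanced, poor and spoiling vertices number at most 1/8, 1/4 and 1/8 of `card (X τ)`,
      -- hence half in all.
      card-bad : card bad < card (X τ)
      card-bad = *-cancelˡ-< 8 (card bad) L (begin-strict
        8 * card bad                ≤⟨ *-monoʳ-≤ 8 (card-∪ (λ v → ∨-split (⋃ unbalancedSet v))) ⟩
        8 * (x + card (λ v → ⋃ poor v ∨ ⋃ spoilingSet v))
                                    ≤⟨ *-monoʳ-≤ 8 (+-monoʳ-≤ x (card-∪ (λ v → ∨-split (⋃ poor v)))) ⟩
        8 * (x + (y + z))           ≡⟨ arrange x y z ⟩
        8 * x + (2 * (4 * y) + 8 * z) ≤⟨ +-mono-≤ x≤ (+-mono-≤ (*-monoʳ-≤ 2 y≤) z≤) ⟩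
        L + (2 * L + L)             ≡⟨ arrange′ L ⟩
        4 * L                       <⟨ *-monoˡ-< L ⦃ >-nonZero L>0 ⦄ {4} {8} (s≤s (s≤s (s≤s (s≤s (s≤s z≤n))))) ⟩
        8 * L                       ∎)
        where
        open ≤-Reasoning
        L = card (X τ)
        x = card (⋃ unbalancedSet)
        y = card (⋃ poor)
        z = card (⋃ spoilingSet)
        arrange : ∀ x y z → 8 * (x + (y + z)) ≡ 8 * x + (2 * (4 * y) + 8 * z)
        arrange = ℕ-Solver.solve-∀
        arrange′ : ∀ l → l + (2 * l + l) ≡ 4 * l
        arrange′ = ℕ-Solver.solve-∀
        ∨-split : ∀ a {b} → a ∨ b ≡ true → a ≡ true ⊎ b ≡ true
        ∨-split true  _ = inj₁ refl
        ∨-split false e = inj₂ e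
        WD≤L : W * D ≤ L
        WD≤L = X-big σ t≤M ≤-refl
        L>0 : 0 < L
        L>0 = <-≤-trans (>-nonZero⁻¹ (W * D) ⦃ m*n≢0 W D ⦄) WD≤L
        tiny : 8 * M * M * D ≤ L
        tiny = ≤-trans (*-monoˡ-≤ D 8MM≤W) WD≤L
        tiny′ : 8 * M * D ≤ L
        tiny′ = ≤-trans (*-monoˡ-≤ D (m≤m*n (8 * M) M)) tiny
        x≤ : 8 * x ≤ L
        x≤ = ⋃-small 8 unbalancedSet (λ j → ≤-trans (*-monoʳ-≤ (8 * M) (≤-trans (card-unb (X j)) B≤D)) tiny′)
        y≤ : 4 * y ≤ L
        y≤ = ⋃-small 4 poor card-poor
        z≤ : 8 * z ≤ L
        z≤ = ⋃-small 8 spoilingSet (λ j → ⋃-small (8 * M) (λ i → ⟦ spoiling? i j ⟧)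
               (λ i → ≤-trans (*-monoʳ-≤ (8 * M * M) (card-spoiling i j)) tiny))

      module Chosen (v : Fin N) (v∈X : v ∈ X τ) (v-ok : v ∉ bad) where

        private
          ∨-false : ∀ a {b} → a ∨ b ≡ false → a ≡ false × b ≡ false
          ∨-false false e = refl , e

          ok₁ : v ∉ ⋃ unbalancedSet
          ok₁ = proj₁ (∨-false (⋃ unbalancedSet v) v-ok)
          ok₂ : v ∉ ⋃ poor
          ok₂ = proj₁ (∨-false (⋃ poor v) (proj₂ (∨-false (⋃ unbalancedSet v) v-ok)))
          ok₃ : v ∉ ⋃ spoilingSet
          ok₃ = proj₂ (∨-false (⋃ poor v) (proj₂ (∨-false (⋃ unbalancedSet v) v-ok)))

          balanced-∉ : ∀ Y → v ∉ unbalanced G D Y → Balanced G D Y v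
          balanced-∉ Y e = ⟦⟧∋ (balanced? G D Y) (flip (⟦ balanced? G D Y ⟧ v) e)
            where
            flip : ∀ b → not b ≡ false → b ≡ true
            flip true _ = refl

        balanced : ∀ j → Balanced G D (X j) v
        balanced j = balanced-∉ (X j) (∉⋃ unbalancedSet ok₁ j)

        not-poor : ∀ j → ¬ Poor j v
        not-poor j p = contra (∉⋃ poor ok₂ j) (∈∩ (X τ) ⟦ poor? j ⟧ v∈X (∈⟦⟧ (poor? j) p))
          where
          contra : ∀ {b} → b ≡ false → b ≡ true → ⊥
          contra refl ()

        card-spoiled : ∀ i j → card (spoiled i j v) ≤ D
        card-spoiled i j = ≮⇒≥ (⟦⟧∌ (spoiling? i j) (∉⋃ (λ i → ⟦ spoiling? i j ⟧) (∉⋃ spoilingSet ok₃ j) i))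

        deleted : Fin n → VSet N
        deleted i x = singleton v x ∨ ⋃ (λ j → spoiled i j v) x

        card-deleted : ∀ i → card (deleted i) ≤ (M + 1) * D
        card-deleted i = begin
          card (deleted i)                                        ≤⟨ card-∪ (λ x → ∨-split (singleton v x)) ⟩
          -- The single vertex `v` is charged as `D`, which is positive.
          card (singleton v) + card (⋃ (λ j → spoiled i j v))     ≤⟨ +-mono-≤ (≤-trans (card-singleton v) (>-nonZero⁻¹ D)) (≤-trans (card-⋃ (λ j → spoiled i j v)) (sum≤ (card-spoiled i))) ⟩
          D + n * D                                               ≤⟨ +-monoʳ-≤ D (*-monoˡ-≤ D n≤M) ⟩
          D + M * D                                               ≡⟨ cong (_* D) (+-comm 1 M) ⟩
          (M + 1) * D                                             ∎
          where
          open ≤-Reasoning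
          ∨-split : ∀ a {b} → a ∨ b ≡ true → a ≡ true ⊎ b ≡ true
          ∨-split true  _ = inj₁ refl
          ∨-split false e = inj₂ e

        h : Fin n → Bool
        h j = adj H τ j

        cut X′ : Fin n → VSet N
        cut j = X j ∩ selected (h j) v
        X′ j = cut j ∩ (λ y → not (deleted j y))

        X′⊆cut : ∀ j → X′ j ⊆ cut j
        X′⊆cut j = ∩∈ˡ (cut j) (λ y → not (deleted j y))

        X′⊆X : ∀ j → X′ j ⊆ X j
        X′⊆X j y e = ∩∈ˡ (X j) (selected (h j) v) y (X′⊆cut j y e)

        X′⊆selected : ∀ j → X′ j ⊆ selected (h j) v
        X′⊆selected j y e = ∩∈ʳ (X j) (selected (h j) v) y (X′⊆cut j y e)

        X′-intact : ∀ j y → y ∈ X′ j → y ∉ deleted j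
        X′-intact j y e = ∉-complement (∩∈ʳ (cut j) (λ y → not (deleted j y)) y e)

        X′-≢ : ∀ j y → y ∈ X′ j → y ≢ v
        X′-≢ j y e = ⟦⟧∌ (Fin._≟ v) (proj₁ (∨-false (singleton v y) (X′-intact j y e)))

        X′-balanced : ∀ i j x → x ∈ X′ i → Balanced G D (X j ∩ nb o x) v
        X′-balanced i j x e = balanced-∉ (X j ∩ nb o x)
          (false-conj (X′⊆X i x e) (∉⋃ (λ j → spoiled i j v) (proj₂ (∨-false (singleton v x) (X′-intact i x e))) j))
          where
          false-conj : ∀ {a b} → a ≡ true → a ∧ b ≡ false → b ≡ false
          false-conj refl e = e

        cut≤ : ∀ j → card (cut j) ≤ card (X′ j) + (M + 1) * D
        cut≤ j = begin
          card (cut j)                                      ≡⟨ card-partition (cut j) (deleted j) ⟨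
          card (X′ j) + card (cut j ∩ deleted j)            ≤⟨ +-monoʳ-≤ (card (X′ j)) (≤-trans (card-⊆ (∩∈ʳ (cut j) (deleted j))) (card-deleted j)) ⟩
          card (X′ j) + (M + 1) * D                         ∎
          where open ≤-Reasoning

        -- At an edge of `H` this is the failure of `Poor`; at a non-edge balancedness gives even
        -- the factor 2.
        X≤cut : ∀ {j} → t < toℕ j → s j ≤ t → card (X j) ≤ R * card (cut j) + D
        X≤cut {j} t<j s≤t with h j
        ... | true  = m≤n⇒m≤n+o D (≮⇒≥ (λ lt → not-poor j ((t<j , s≤t) , lt)))
        ... | false = ≤-trans (proj₂ (balanced-pattern G D false (X j) (balanced j)))
                        (+-monoˡ-≤ D (*-monoˡ-≤ (card (X j ∩ (λ y → not (adj G v y)))) 2≤R))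

        -- Twice `card (X j)` is estimated, so that one copy can absorb the deletions and the
        -- discrepancy, which amount to `W * D`.
        X≤ΓX′ : ∀ {j} → t < toℕ j → s j ≤ t → card (X j) ≤ Γ * card (X′ j)
        X≤ΓX′ {j} t<j s≤t = +-cancelʳ-≤ (card (X j)) _ _ (begin
          x + x                                   ≡⟨ cong (λ z → x + z) (+-identityʳ x) ⟨
          2 * x                                   ≤⟨ *-monoʳ-≤ 2 (≤-trans (X≤cut t<j s≤t) (+-monoˡ-≤ D (*-monoʳ-≤ R (cut≤ j)))) ⟩
          2 * (R * (x′ + (M + 1) * D) + D)        ≤⟨ *-monoʳ-≤ 2 (+-monoʳ-≤ (R * (x′ + (M + 1) * D)) (m≤n*m D R ⦃ >-nonZero (≤-trans (s≤s z≤n) 2≤R) ⦄)) ⟩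
          2 * (R * (x′ + (M + 1) * D) + R * D)    ≡⟨ arrange R x′ M D ⟩
          2 * R * x′ + 2 * (R * (M + 2)) * D      ≡⟨ cong₂ (λ g w → g * x′ + w * D) Γ≡ W≡ ⟨
          Γ * x′ + W * D                          ≤⟨ +-monoʳ-≤ (Γ * x′) (X-big σ t≤M (<⇒≤ t<j)) ⟩
          Γ * x′ + x                              ∎)
          where
          open ≤-Reasoning
          x = card (X j)
          x′ = card (X′ j)
          arrange : ∀ r x m d → 2 * (r * (x + (m + 1) * d) + r * d) ≡ 2 * r * x + 2 * (r * (m + 2)) * d
          arrange = ℕ-Solver.solve-∀

        -- Beyond the halving, what is lost are the wrong-colour neighbours of `v` and, within
        -- (2M+3)`D`, the deletions and the discrepancy.
        X≤2X′ : ∀ j → card (X j) ≤ 2 * card (X′ j) + 2 * deg o v (X j) + E * D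
        X≤2X′ j = begin
          card (X j)                              ≤⟨ proj₂ (balanced-pattern G D (h j) (X j) (balanced j)) ⟩
          2 * card (X j ∩ pattern-set G (h j) v) + D ≤⟨ +-monoˡ-≤ D (*-monoʳ-≤ 2 (card-∪ cover)) ⟩
          2 * (card (cut j) + d) + D              ≤⟨ +-monoˡ-≤ D (*-monoʳ-≤ 2 (+-monoˡ-≤ d (cut≤ j))) ⟩
          2 * (x′ + (M + 1) * D + d) + D          ≡⟨ arrange x′ M D d ⟩
          2 * x′ + 2 * d + (2 * M + 3) * D        ≤⟨ +-monoʳ-≤ (2 * x′ + 2 * d) (*-monoˡ-≤ D 2M+3≤E) ⟩
          2 * x′ + 2 * d + E * D                  ∎
          where
          open ≤-Reasoning
          x′ = card (X′ j)
          d = deg o v (X j)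
          cover : ∀ y → y ∈ X j ∩ pattern-set G (h j) v → y ∈ cut j ⊎ y ∈ X j ∩ nb o v
          cover y e with pattern⊆ (h j) v y (∩∈ʳ (X j) (pattern-set G (h j) v) y e)
          ... | inj₁ p = inj₁ (∈∩ (X j) (selected (h j) v) (∩∈ˡ (X j) (pattern-set G (h j) v) y e) p)
          ... | inj₂ p = inj₂ (∈∩ (X j) (nb o v) (∩∈ˡ (X j) (pattern-set G (h j) v) y e) p)
          arrange : ∀ x m d e → 2 * (x + (m + 1) * d + e) + d ≡ 2 * x + 2 * e + (2 * m + 3) * d
          arrange = ℕ-Solver.solve-∀
          2M+3≤E : 2 * M + 3 ≤ E
          2M+3≤E = begin
            2 * M + 3      ≤⟨ +-monoʳ-≤ (2 * M) (m≤m*n 3 M) ⟩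
            2 * M + 3 * M  ≡⟨ *-distribʳ-+ M 2 3 ⟨
            5 * M          ≤⟨ *-monoˡ-≤ M {5} {8} (s≤s (s≤s (s≤s (s≤s (s≤s z≤n))))) ⟩
            8 * M          ≡⟨ E≡ ⟨
            E              ∎

        -- By `spread`, the wrong-colour degree costs two more copies of `card (u j)`, which raises
        -- 2t to 2(t+1). The new `D`-terms are at most the old one, which therefore doubles.
        fresh′ : ∀ {j} → t < toℕ j → t < s j →
          E * card (u j) ≤ E * (2 ^ suc t * card (X′ j)) + 2 * suc t * card (u j) + E * E * (2 ^ suc (suc t) * D)
        fresh′ {j} t<j t<s = begin
          E * k                                     ≤⟨ fresh σ (<⇒≤ t<j) (<⇒≤ t<s) ⟩
          E * (p * card (X j)) + 2 * t * k + E * E * (2 * p * D)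
            ≤⟨ +-monoˡ-≤ _ (+-monoˡ-≤ (2 * t * k) (*-monoʳ-≤ E (*-monoʳ-≤ p (X≤2X′ j)))) ⟩
          E * (p * (2 * x′ + 2 * d + E * D)) + 2 * t * k + E * E * (2 * p * D)
            ≡⟨ e₁ E p x′ d D t k ⟩
          E * (2 * p * x′) + 2 * (E * (p * d)) + (2 * t * k + 3 * (E * E * (p * D)))
            ≤⟨ +-monoˡ-≤ _ (+-monoʳ-≤ (E * (2 * p * x′)) (*-monoʳ-≤ 2 (spread σ ≤-refl t<s v v∈X))) ⟩
          E * (2 * p * x′) + 2 * (k + E * (p * D)) + (2 * t * k + 3 * (E * E * (p * D)))
            ≡⟨ e₂ E (2 * p * x′) k (p * D) t ⟩
          E * (2 * p * x′) + 2 * suc t * k + (2 * E * (p * D) + 3 * (E * E * (p * D)))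
            ≤⟨ +-monoʳ-≤ (E * (2 * p * x′) + 2 * suc t * k) (+-monoˡ-≤ (3 * (E * E * (p * D))) (*-monoˡ-≤ (p * D) (*-monoˡ-≤ E 2≤E))) ⟩
          E * (2 * p * x′) + 2 * suc t * k + (E * E * (p * D) + 3 * (E * E * (p * D)))
            ≡⟨ cong (λ z → E * (2 * p * x′) + 2 * suc t * k + z) (e₃ (E * E) p D) ⟩
          E * (2 * p * x′) + 2 * suc t * k + E * E * (2 * (2 * p) * D) ∎
          where
          open ≤-Reasoning
          p = 2 ^ t
          k = card (u j)
          x′ = card (X′ j)
          d = deg o v (X j)
          2≤E : 2 ≤ E
          2≤E = subst (2 ≤_) (sym E≡) (≤-trans (s≤s (s≤s z≤n)) (m≤m*n 8 M))
          e₁ : ∀ e p x d b t k → e * (p * (2 * x + 2 * d + e * b)) + 2 * t * k + e * e * (2 * p * b) ≡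
               e * (2 * p * x) + 2 * (e * (p * d)) + (2 * t * k + 3 * (e * e * (p * b)))
          e₁ = ℕ-Solver.solve-∀
          e₂ : ∀ e x k b t → e * x + 2 * (k + e * b) + (2 * t * k + 3 * (e * e * b)) ≡
               e * x + 2 * suc t * k + (2 * e * b + 3 * (e * e * b))
          e₂ = ℕ-Solver.solve-∀
          e₃ : ∀ e p d → e * (p * d) + 3 * (e * (p * d)) ≡ e * (2 * (2 * p) * d)
          e₃ = ℕ-Solver.solve-∀

        opened′ : ∀ {j} → t < toℕ j → s j ≤ suc t → card (u j) ≤ α * Γ ^ (suc t ∸ s j) * card (X′ j)
        opened′ {j} t<j s≤ with s j ≤? t
        ... | yes s≤t = begin
          card (u j)                                ≤⟨ opened σ (<⇒≤ t<j) s≤t ⟩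
          α * Γ ^ (t ∸ s j) * card (X j)            ≤⟨ *-monoʳ-≤ (α * Γ ^ (t ∸ s j)) (X≤ΓX′ t<j s≤t) ⟩
          α * Γ ^ (t ∸ s j) * (Γ * card (X′ j))     ≡⟨ arrange α (Γ ^ (t ∸ s j)) Γ (card (X′ j)) ⟩
          α * Γ ^ suc (t ∸ s j) * card (X′ j)       ≡⟨ cong (λ e → α * Γ ^ e * card (X′ j)) (+-∸-assoc 1 s≤t) ⟨
          α * Γ ^ (suc t ∸ s j) * card (X′ j)       ∎
          where
          open ≤-Reasoning
          arrange : ∀ a p g x → a * p * (g * x) ≡ a * (g * p) * x
          arrange = ℕ-Solver.solve-∀
        -- The interval of `j` begins exactly at `suc t`: the exponent of `Γ` is 0 and the fresh
        -- estimate becomes the opened one.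
        ... | no s≰t rewrite m≤n⇒m∸n≡0 (≰⇒> s≰t) | *-identityʳ α =
          fresh⇒ (<M τ) (u-big j) (fresh′ t<j (≰⇒> s≰t))

        -- A surviving `x` is not spoiled, so `v` halves `X j ∩ nb o x` up to `D`; what `x` keeps in
        -- `X′ j` lies in that half.
        spread′ : ∀ {i j} → t < toℕ i → toℕ i < s j → ∀ x → x ∈ X′ i →
          E * (2 ^ suc t * deg o x (X′ j)) ≤ card (u j) + E * (2 ^ suc t * D)
        spread′ {i} {j} t<i i<s x e = begin
          E * (2 * p * deg o x (X′ j))                ≤⟨ *-monoʳ-≤ E (*-monoʳ-≤ (2 * p) (card-⊆ shrink)) ⟩
          E * (2 * p * card (Y ∩ P))                  ≡⟨ e₁ E p (card (Y ∩ P)) ⟩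
          E * (p * (2 * card (Y ∩ P)))                ≤⟨ *-monoʳ-≤ E (*-monoʳ-≤ p (proj₁ (balanced-pattern G D (h j) Y (X′-balanced i j x e)))) ⟩
          E * (p * (card Y + D))                      ≡⟨ e₂ E p (card Y) D ⟩
          E * (p * card Y) + E * (p * D)              ≤⟨ +-monoˡ-≤ (E * (p * D)) (spread σ (<⇒≤ t<i) i<s x (X′⊆X i x e)) ⟩
          card (u j) + E * (p * D) + E * (p * D)      ≡⟨ e₃ (card (u j)) E p D ⟩
          card (u j) + E * (2 * p * D)                ∎
          where
          open ≤-Reasoning
          p = 2 ^ t
          Y P : VSet N
          Y = X j ∩ nb o x
          P = pattern-set G (h j) v
          shrink : X′ j ∩ nb o x ⊆ Y ∩ P
          shrink y y∈ = ∈∩ Y P (∈∩ (X j) (nb o x) (X′⊆X j y y∈X′) (∩∈ʳ (X′ j) (nb o x) y y∈))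
                               (selected⊆pattern (h j) v y (X′⊆selected j y y∈X′))
            where
            y∈X′ = ∩∈ˡ (X′ j) (nb o x) y y∈
          e₁ : ∀ e p y → e * (2 * p * y) ≡ e * (p * (2 * y))
          e₁ = ℕ-Solver.solve-∀
          e₂ : ∀ e p y d → e * (p * (y + d)) ≡ e * (p * y) + e * (p * d)
          e₂ = ℕ-Solver.solve-∀
          e₃ : ∀ k e p d → k + e * (p * d) + e * (p * d) ≡ k + e * (2 * p * d)
          e₃ = ℕ-Solver.solve-∀

        next : State (suc t) X′
        next = record
          { inside = λ {j} t<j v e → inside σ (<⇒≤ t<j) v (X′⊆X j v e)
          ; fresh  = fresh′
          ; opened = opened′
          ; spread = spread′ }

        extension-by : Extension τ X
        extension-by = record
          { vertex = v ; vertex∈ = v∈X ; rest = X′ ; rest⊆ = X′⊆X ; joined = X′⊆selected ; vertex∉ = X′-≢ ; state = next }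

      extension : Extension τ X
      extension = extend (∃-avoiding (X τ) bad card-bad)
        where
        extend : ∃[ v ] (v ∈ X τ × v ∉ bad) → Extension τ X
        extend (v , v∈X , v-ok) = Chosen.extension-by v v∈X v-ok

    start : State 0 u
    start = record
      { inside = λ _ _ e → e
      ; fresh  = λ {j} _ _ → ≤-trans (*-monoʳ-≤ E (≤-reflexive (sym (+-identityʳ (card (u j))))))
                   (≤-trans (m≤m+n _ 0) (m≤m+n (E * (1 * card (u j)) + 0) (E * E * (2 * D))))
      ; opened = λ {j} _ _ → subst (λ e → card (u j) ≤ α * Γ ^ e * card (u j)) (sym (0∸n≡0 (s j)))
                   (m≤n*m (card (u j)) (α * 1) ⦃ m*n≢0 α 1 ⦄)
      ; spread = λ {i} {j} _ i<s x e → ≤-trans (*-monoʳ-≤ E (≤-reflexive (+-identityʳ (deg o x (u j)))))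
                   (≤-trans (cross S (<M j) i<s x e) (m≤m+n (card (u j)) _)) }

    -- Assembling the chosen vertices into a copy

    -- Only slots from `t` on are constrained. The vertices of earlier slots enter through the sets
    -- `X`, which have already been cut down to them.
    record Placement (t : ℕ) (X : Fin n → VSet N) : Set where
      field
        place    : Fin n → Fin N
        place∈   : ∀ {j} → t ≤ toℕ j → place j ∈ X j
        compat   : ∀ {i j} → t ≤ toℕ i → toℕ i < toℕ j → place j ∈ selected (adj H i j) (place i)
        distinct : ∀ {i j} → t ≤ toℕ i → toℕ i < toℕ j → place j ≢ place i

    module _ (τ : Fin n) {X : Fin n → VSet N} (ε : Extension τ X)
      (π : Placement (suc (toℕ τ)) (Extension.rest ε)) where

      private
        module E = Extension ε
        module P = Placement π

        place : Fin n → Fin N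
        place j = if does (j Fin.≟ τ) then E.vertex else P.place j

        at-τ : place τ ≡ E.vertex
        at-τ = cong (λ b → if b then E.vertex else P.place τ) (dec-true (τ Fin.≟ τ) refl)

        past-τ : ∀ {j} → toℕ τ < toℕ j → place j ≡ P.place j
        past-τ {j} τ<j = cong (λ b → if b then E.vertex else P.place j)
          (dec-false (j Fin.≟ τ) (λ eq → <-irrefl (cong toℕ (sym eq)) τ<j))

        from-τ : ∀ {Q : Fin n → Set} → Q τ → (∀ {j} → toℕ τ < toℕ j → Q j) → ∀ {j} → toℕ τ ≤ toℕ j → Q j
        from-τ {Q} base later τ≤j with m≤n⇒m<n∨m≡n τ≤j
        ... | inj₁ τ<j = later τ<j
        ... | inj₂ eq  = subst Q (Fin.toℕ-injective eq) base

      prepend : Placement (toℕ τ) X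
      prepend = record
        { place    = place
        ; place∈   = from-τ {λ j → place j ∈ X j} (subst (_∈ X τ) (sym at-τ) E.vertex∈)
            (λ {j} τ<j → subst (_∈ X j) (sym (past-τ τ<j)) (E.rest⊆ j (P.place j) (P.place∈ τ<j)))
        ; compat   = λ {i} {j} τ≤i → from-τ {λ i → toℕ i < toℕ j → place j ∈ selected (adj H i j) (place i)}
            (λ τ<j → subst₂ (λ y x → y ∈ selected (adj H τ j) x) (sym (past-τ τ<j)) (sym at-τ)
              (E.joined j (P.place j) (P.place∈ τ<j)))
            (λ {i} τ<i i<j → subst₂ (λ y x → y ∈ selected (adj H i j) x) (sym (past-τ (<-trans τ<i i<j))) (sym (past-τ τ<i))
              (P.compat τ<i i<j))
            τ≤i
        ; distinct = λ {i} {j} τ≤i → from-τ {λ i → toℕ i < toℕ j → place j ≢ place i}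
            (λ τ<j → subst₂ _≢_ (sym (past-τ τ<j)) (sym at-τ) (E.vertex∉ j (P.place j) (P.place∈ τ<j)))
            (λ {i} τ<i i<j → subst₂ _≢_ (sym (past-τ (<-trans τ<i i<j))) (sym (past-τ τ<i)) (P.distinct τ<i i<j))
            τ≤i }

    greedy : Fin N → ∀ r {t} → r + t ≡ n → ∀ X → State t X → Placement t X
    -- All slots are filled, so every condition is vacuous and `v₀` is a mere default value.
    greedy v₀ zero refl X σ = record
      { place    = λ _ → v₀
      ; place∈   = λ {j} n≤j → ⊥-elim (<⇒≱ (Fin.toℕ<n j) n≤j)
      ; compat   = λ {i} n≤i → ⊥-elim (<⇒≱ (Fin.toℕ<n i) n≤i)
      ; distinct = λ {i} n≤i → ⊥-elim (<⇒≱ (Fin.toℕ<n i) n≤i) }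
    greedy v₀ (suc r) {t} r+t≡n X σ = go (fromℕ< t<n) (Fin.toℕ-fromℕ< t<n)
      where
      t<n : t < n
      t<n = subst (t <_) r+t≡n (s≤s (m≤n+m t r))
      go : (τ : Fin n) → toℕ τ ≡ t → Placement t X
      go τ refl = continue (Step.extension τ X σ)
        where
        continue : Extension τ X → Placement (toℕ τ) X
        continue ε = prepend τ ε (greedy v₀ r (trans (+-suc r t) r+t≡n) (Extension.rest ε) (Extension.state ε))

    copy : Placement 0 u → Σ (InducedCopy H G) λ φ → Σ Bool λ d →
      (∀ i j → adj H i j ≡ true → col κ (emb φ i) (emb φ j) ≡ d)
    copy π = record { emb = place ; embInj = λ {i} {j} → injective i j ; embInduced = induced } , c , colour
      where
      open Placement π
      trichotomy : ∀ i j → (i ≡ j) ⊎ (toℕ i < toℕ j) ⊎ (toℕ j < toℕ i)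
      trichotomy i j with <-cmp (toℕ i) (toℕ j)
      ... | tri< lt _ _ = inj₂ (inj₁ lt)
      ... | tri≈ _ eq _ = inj₁ (Fin.toℕ-injective eq)
      ... | tri> _ _ gt = inj₂ (inj₂ gt)
      injective : ∀ i j → place i ≡ place j → i ≡ j
      injective i j eq with trichotomy i j
      ... | inj₁ i≡j = i≡j
      ... | inj₂ (inj₁ lt) = ⊥-elim (distinct z≤n lt (sym eq))
      ... | inj₂ (inj₂ gt) = ⊥-elim (distinct z≤n gt eq)
      pattern-adj : ∀ b x y → y ∈ pattern-set G b x → adj G x y ≡ b
      pattern-adj true  x y e = e
      pattern-adj false x y e = ∉-complement e
      forward : ∀ {i j} → toℕ i < toℕ j → adj G (place i) (place j) ≡ adj H i j
      forward {i} {j} lt = pattern-adj (adj H i j) (place i) (place j)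
        (selected⊆pattern (adj H i j) (place i) (place j) (compat z≤n lt))
      induced : ∀ i j → adj G (place i) (place j) ≡ adj H i j
      induced i j with trichotomy i j
      ... | inj₁ refl = trans (irrefl G (place i)) (sym (irrefl H i))
      ... | inj₂ (inj₁ lt) = forward lt
      ... | inj₂ (inj₂ gt) = trans (Graph.sym G (place i) (place j)) (trans (forward gt) (Graph.sym H j i))
      forward-colour : ∀ {i j} → toℕ i < toℕ j → adj H i j ≡ true → col κ (place i) (place j) ≡ c
      forward-colour {i} {j} lt e = decode (∩∈ʳ (adj G (place i)) (λ y → does (col κ (place i) y Bool.≟ c)) (place j)
        (subst (λ b → place j ∈ selected b (place i)) e (compat z≤n lt)))
        where
        decode : does (col κ (place i) (place j) Bool.≟ c) ≡ true → col κ (place i) (place j) ≡ c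
        decode p with col κ (place i) (place j) Bool.≟ c
        ... | yes q = q
      colour : ∀ i j → adj H i j ≡ true → col κ (place i) (place j) ≡ c
      colour i j e with trichotomy i j
      ... | inj₁ refl with trans (sym e) (irrefl H i)
      ...   | ()
      colour i j e | inj₂ (inj₁ lt) = forward-colour lt e
      colour i j e | inj₂ (inj₂ gt) =
        trans (colSym κ (place i) (place j) (trans (induced i j) e)) (forward-colour gt (trans (Graph.sym H j i) e))

    monochromatic-copy : Fin N → Σ (InducedCopy H G) λ φ → Σ Bool λ d →
      (∀ i j → adj H i j ≡ true → col κ (emb φ i) (emb φ j) ≡ d)
    monochromatic-copy v₀ = copy (greedy v₀ n (+-identityʳ n) u start)

-- Choice of parameters

module _ {N n : ℕ} (G : Graph N) (H : Graph n) (k D B E R α β Γ W f : ℕ)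
  ⦃ _ : NonZero E ⦄ ⦃ _ : NonZero β ⦄ ⦃ _ : NonZero Γ ⦄ ⦃ _ : NonZero f ⦄
  ⦃ _ : NonZero D ⦄ ⦃ _ : NonZero α ⦄ ⦃ _ : NonZero W ⦄
  (R≡ : R ≡ 4 * 2 ^ k * E) (E≡ : E ≡ 8 * 2 ^ k) (α≡ : α ≡ 2 * 2 ^ (2 ^ k)) (β≡ : β ≡ 4 * 2 ^ k * α) (Γ≡ : Γ ≡ 2 * R)
  (W≡ : W ≡ 2 * (R * (2 ^ k + 2))) (f≡ : f ≡ α * Γ ^ (2 ^ k) * (W * D))
  (card-unb : ∀ Y → card (unbalanced G D Y) ≤ B) (B≤D : B ≤ D) (NB≤DD : N * B ≤ D * D)
  (n≤M : n ≤ 2 ^ k) (size≤N : f * ((2 * β) ^ (k + k) * Γ ^ (2 * (2 ^ k + 2 ^ k))) ≤ N)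
  where

  private instance
    M≢0 : NonZero (2 ^ k)
    M≢0 = m^n≢0 2 k

  ramsey : Fin N → IndRamseyFor H G
  ramsey v₀ κ with Structures.structure (coloured κ) (coloured-sym κ) (2 ^ k) E R β Γ f R≡ true false k k ≤-refl ≤-refl
    (λ _ → true) (≤-trans size≤N (≤-reflexive (sym (trans (sum-const N 1) (*-identityʳ N)))))
  ... | inj₁ S = Embedding.monochromatic-copy G H κ true false (λ { true → inj₁ refl ; false → inj₂ refl })
    (2 ^ k) D B E R α β Γ W f R≡ E≡ α≡ β≡ Γ≡ W≡ f≡ card-unb B≤D NB≤DD S n≤M v₀
  ... | inj₂ S = Embedding.monochromatic-copy G H κ false true (λ { true → inj₂ refl ; false → inj₁ refl })
    (2 ^ k) D B E R α β Γ W f R≡ E≡ α≡ β≡ Γ≡ W≡ f≡ card-unb B≤D NB≤DD S n≤M v₀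

-- A base-2 exponent for the size needed at the root, divided by `D`. The summands belong in turn to
-- `α`, `Γ ^ M`, `W`, `(2 * β) ^ (k + k)` and `Γ ^ (2 * (M + M))`.
rank : ℕ → ℕ → ℕ
rank k M = M + 1 + (2 * k + 6) * M + (3 * k + 8) + (k + M + 4) * (k + k) + (2 * k + 6) * (2 * (M + M))

rank≤ : ∀ k M → 1 ≤ k → k ≤ M → rank k M ≤ 65 * (k * M)
rank≤ (suc k) M _ k<M with m≤n⇒∃[o]m+o≡n k<M
... | d , refl = m+n≤o⇒m≤o (rank (suc k) (suc k + d)) (≤-reflexive (slack k d))
  where
  -- With `M` written as `suc k + d`, the difference has no negative coefficients. The constant 65
  -- is `rank 1 1`, so equality holds there.
  slack : ∀ k d → (suc k + d + 1 + (2 * suc k + 6) * (suc k + d) + (3 * suc k + 8) + (suc k + (suc k + d) + 4) * (suc k + suc k) + (2 * suc k + 6) * (2 * (suc k + d + (suc k + d)))) + (51 * (k * k) + 53 * (k * d) + 60 * k + 22 * d) ≡ 65 * (suc k * (suc k + d))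
  slack = ℕ-Solver.solve-∀

*-≤-2^ : ∀ {a b x y} → a ≤ 2 ^ x → b ≤ 2 ^ y → a * b ≤ 2 ^ (x + y)
*-≤-2^ {x = x} {y} p q = subst (_ ≤_) (sym (^-distribˡ-+-* 2 x y)) (*-mono-≤ p q)

^-≤-2^ : ∀ {a x} e → a ≤ 2 ^ x → a ^ e ≤ 2 ^ (x * e)
^-≤-2^ {x = x} e p = subst (_ ≤_) (^-*-assoc 2 x e) (^-monoˡ-≤ e p)

4^≡2^ : ∀ e → 4 ^ e ≡ 2 ^ (2 * e)
4^≡2^ = ^-*-assoc 2 2

module _ (k : ℕ) where

  private
    M = 2 ^ k
    r = rank k M

  E′ R′ Γ′ α′ β′ W′ D′ B′ f′ : ℕ
  E′ = 8 * M
  R′ = 4 * M * E′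
  Γ′ = 2 * R′
  α′ = 2 * 2 ^ M
  β′ = 4 * M * α′
  W′ = 2 * (R′ * (M + 2))
  -- The order `N` is `4 ^ (2 * r)`, which is 2^(4r), so `D′` is N^(3/4) and `B′` is N^(1/2). This
  -- balances N·N = B·D·D with N·B = D·D, and the root size, at most 2^r·D, fits into `N` exactly.
  D′ = 2 ^ (3 * r)
  B′ = 2 ^ (2 * r)
  f′ = α′ * Γ′ ^ M * (W′ * D′)

  private
    at : ∀ {a x y} → x ≡ y → a ≤ 2 ^ x → a ≤ 2 ^ y
    at refl p = p

    4M≤ : 4 * M ≤ 2 ^ (2 + k)
    4M≤ = *-≤-2^ {4} {M} {2} {k} ≤-refl ≤-refl

    E≤ : E′ ≤ 2 ^ (3 + k)
    E≤ = *-≤-2^ {8} {M} {3} {k} ≤-refl ≤-refl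

    R≤ : R′ ≤ 2 ^ (2 + k + (3 + k))
    R≤ = *-≤-2^ {4 * M} {E′} {2 + k} {3 + k} 4M≤ E≤

    Γ≤ : Γ′ ≤ 2 ^ (2 * k + 6)
    Γ≤ = at (exponent k) (*-≤-2^ {2} {R′} {1} {2 + k + (3 + k)} ≤-refl R≤)
      where
      exponent : ∀ k → 1 + (2 + k + (3 + k)) ≡ 2 * k + 6
      exponent = ℕ-Solver.solve-∀

    α≤ : α′ ≤ 2 ^ (M + 1)
    α≤ = at (+-comm 1 M) ≤-refl

    2β≤ : 2 * β′ ≤ 2 ^ (k + M + 4)
    2β≤ = at (exponent k M) (*-≤-2^ {2} {β′} {1} {2 + k + (M + 1)} ≤-refl (*-≤-2^ {4 * M} {α′} {2 + k} {M + 1} 4M≤ α≤))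
      where
      exponent : ∀ k m → 1 + (2 + k + (m + 1)) ≡ k + m + 4
      exponent = ℕ-Solver.solve-∀

    W≤ : W′ ≤ 2 ^ (3 * k + 8)
    W≤ = at (exponent k) (*-≤-2^ {2} {R′ * (M + 2)} {1} {2 + k + (3 + k) + (2 + k)} ≤-refl (*-≤-2^ {R′} {M + 2} {2 + k + (3 + k)} {2 + k} R≤ M+2≤))
      where
      exponent : ∀ k → 1 + (2 + k + (3 + k) + (2 + k)) ≡ 3 * k + 8
      exponent = ℕ-Solver.solve-∀
      M+2≤ : M + 2 ≤ 2 ^ (2 + k)
      M+2≤ = ≤-trans (+-monoʳ-≤ M (≤-trans (m≤m*n 2 M ⦃ m^n≢0 2 k ⦄) (m≤m+n (2 * M) M)))
        (≤-trans (≤-reflexive (sum-M M)) 4M≤)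
        where
        sum-M : ∀ m → m + (2 * m + m) ≡ 4 * m
        sum-M = ℕ-Solver.solve-∀

    size≤ : f′ * ((2 * β′) ^ (k + k) * Γ′ ^ (2 * (M + M))) ≤ 4 ^ (2 * r)
    size≤ = ≤-trans (at exponent
      (*-≤-2^ {x = M + 1 + (2 * k + 6) * M + (3 * k + 8 + 3 * r)}
        (*-≤-2^ {x = M + 1 + (2 * k + 6) * M}
          (*-≤-2^ {x = M + 1} α≤ (^-≤-2^ {x = 2 * k + 6} M Γ≤))
          (*-≤-2^ {x = 3 * k + 8} {3 * r} W≤ ≤-refl))
        (*-≤-2^ {x = (k + M + 4) * (k + k)} (^-≤-2^ {x = k + M + 4} (k + k) 2β≤) (^-≤-2^ {x = 2 * k + 6} (2 * (M + M)) Γ≤)))) (≤-reflexive (sym (4^≡2^ (2 * r))))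
      where
      regroup : ∀ a b c d r → a + (b + 3 * r) + (c + d) ≡ a + b + c + d + 3 * r
      regroup = ℕ-Solver.solve-∀
      fourfold : ∀ r → r + 3 * r ≡ 2 * (2 * r)
      fourfold = ℕ-Solver.solve-∀
      exponent : M + 1 + (2 * k + 6) * M + (3 * k + 8 + 3 * r) + ((k + M + 4) * (k + k) + (2 * k + 6) * (2 * (M + M))) ≡ 2 * (2 * r)
      exponent = trans (regroup (M + 1 + (2 * k + 6) * M) (3 * k + 8) ((k + M + 4) * (k + k)) ((2 * k + 6) * (2 * (M + M))) r) (fourfold r)

    instance
      M≢0 : NonZero M
      M≢0 = m^n≢0 2 k
      2^M≢0 : NonZero (2 ^ M)
      2^M≢0 = m^n≢0 2 M
      E≢0 : NonZero E′
      E≢0 = m*n≢0 8 M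
      R≢0 : NonZero R′
      R≢0 = m*n≢0 (4 * M) E′ ⦃ m*n≢0 4 M ⦄
      Γ≢0 : NonZero Γ′
      Γ≢0 = m*n≢0 2 R′
      α≢0 : NonZero α′
      α≢0 = m*n≢0 2 (2 ^ M)
      β≢0 : NonZero β′
      β≢0 = m*n≢0 (4 * M) α′ ⦃ m*n≢0 4 M ⦄
      W≢0 : NonZero W′
      W≢0 = m*n≢0 2 (R′ * (M + 2)) ⦃ it ⦄ ⦃ m*n≢0 R′ (M + 2) ⦃ it ⦄ ⦃ >-nonZero (m≤n⇒m≤o+n M (s≤s z≤n)) ⦄ ⦄
      D≢0 : NonZero D′
      D≢0 = m^n≢0 2 (3 * r)
      f≢0 : NonZero f′
      f≢0 = m*n≢0 (α′ * Γ′ ^ M) (W′ * D′) ⦃ m*n≢0 α′ (Γ′ ^ M) ⦃ it ⦄ ⦃ m^n≢0 Γ′ M ⦄ ⦄ ⦃ m*n≢0 W′ D′ ⦄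

    NB≡DD : 4 ^ (2 * r) * B′ ≡ D′ * D′
    NB≡DD = begin
      4 ^ (2 * r) * 2 ^ (2 * r)         ≡⟨ cong (_* 2 ^ (2 * r)) (4^≡2^ (2 * r)) ⟩
      2 ^ (2 * (2 * r)) * 2 ^ (2 * r)   ≡⟨ ^-distribˡ-+-* 2 (2 * (2 * r)) (2 * r) ⟨
      2 ^ (2 * (2 * r) + 2 * r)         ≡⟨ cong (2 ^_) (exponent r) ⟩
      2 ^ (3 * r + 3 * r)               ≡⟨ ^-distribˡ-+-* 2 (3 * r) (3 * r) ⟩
      D′ * D′                           ∎
      where
      open ≡-Reasoning
      exponent : ∀ r → 2 * (2 * r) + 2 * r ≡ 3 * r + 3 * r
      exponent = ℕ-Solver.solve-∀

    NN≡BDD : 4 ^ (2 * r) * 4 ^ (2 * r) ≡ B′ * (D′ * D′)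
    NN≡BDD = begin
      4 ^ (2 * r) * 4 ^ (2 * r)          ≡⟨ cong (4 ^ (2 * r) *_) (trans (4^≡2^ (2 * r)) (trans (cong (2 ^_) (cong (λ z → 2 * r + z) (+-identityʳ (2 * r)))) (^-distribˡ-+-* 2 (2 * r) (2 * r)))) ⟩
      4 ^ (2 * r) * (B′ * B′)            ≡⟨ arrange (4 ^ (2 * r)) B′ ⟩
      B′ * (4 ^ (2 * r) * B′)            ≡⟨ cong (B′ *_) NB≡DD ⟩
      B′ * (D′ * D′)                     ∎
      where
      open ≡-Reasoning
      arrange : ∀ n b → n * (b * b) ≡ b * (n * b)
      arrange = ℕ-Solver.solve-∀

  symplectic-ramsey : ∀ {n} (H : Graph n) → n ≤ M → IndRamseyFor H (symplectic (2 * r))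
  symplectic-ramsey H n≤M = ramsey (symplectic (2 * r)) H k D′ B′ E′ R′ α′ β′ Γ′ W′ f′ refl refl refl refl refl refl refl
    (λ Y → *-cancelʳ-≤ _ _ (D′ * D′) ⦃ m*n≢0 D′ D′ ⦄ (≤-trans (card-unbalanced (2 * r) D′ Y) (≤-reflexive NN≡BDD)))
    (^-monoʳ-≤ 2 (*-monoˡ-≤ r (s≤s (s≤s (z≤n {1})))))
    (≤-reflexive NB≡DD) n≤M size≤ (fromℕ< (>-nonZero⁻¹ (4 ^ (2 * r)) ⦃ m^n≢0 4 (2 * r) ⦄))

-- The bound in terms of the number of vertices

dyadic : ∀ n → 1 ≤ n → ∃[ k ] (n ≤ 2 ^ k × 2 ^ k ≤ 2 * n)
dyadic (suc zero) _ = 0 , ≤-refl , s≤s z≤n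
dyadic (suc (suc n)) _ with dyadic (suc n) (s≤s z≤n)
... | k , lo , hi with suc (suc n) ≤? 2 ^ k
...   | yes le = k , le , ≤-trans hi (*-monoʳ-≤ 2 (n≤1+n (suc n)))
...   | no  ≰  = suc k , ≤-trans (≤-trans (+-monoˡ-≤ (suc n) (s≤s z≤n)) (≤-reflexive (cong (λ z → suc n + z) (sym (+-identityʳ (suc n)))))) (*-monoʳ-≤ 2 lo)
                       , *-monoʳ-≤ 2 (≤-pred (≰⇒> (λ le → ≰ (≤-trans (n≤1+n _) le))))

-- With `M ≤ 2 * n ≤ n * n` the base `M` is replaced by the square of `n`. The constant is 4 · 65
-- from the order, times 2 for the square, times 2 for `M` against `n`.
symplectic-order≤ : ∀ n → 2 ≤ n → ∀ k → 1 ≤ k → 2 ^ k ≤ 2 * n → 4 ^ (2 * rank k (2 ^ k)) ≤ n ^ (1040 * n)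
symplectic-order≤ n 2≤n k 1≤k M≤2n = begin
  4 ^ (2 * rank k M)             ≡⟨ 4^≡2^ (2 * rank k M) ⟩
  2 ^ (2 * (2 * rank k M))       ≤⟨ ^-monoʳ-≤ 2 (*-monoʳ-≤ 2 (*-monoʳ-≤ 2 (rank≤ k M 1≤k (<⇒≤ (n<2^n k))))) ⟩
  2 ^ (2 * (2 * (65 * (k * M)))) ≡⟨ cong (2 ^_) (e₁ k M) ⟩
  2 ^ (k * (260 * M))            ≡⟨ ^-*-assoc 2 k (260 * M) ⟨
  M ^ (260 * M)                  ≤⟨ ^-monoˡ-≤ (260 * M) (≤-trans M≤2n (*-monoˡ-≤ n 2≤n)) ⟩
  (n * n) ^ (260 * M)            ≡⟨ cong (λ m → (n * m) ^ (260 * M)) (*-identityʳ n) ⟨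
  (n ^ 2) ^ (260 * M)            ≡⟨ ^-*-assoc n 2 (260 * M) ⟩
  n ^ (2 * (260 * M))            ≤⟨ ^-monoʳ-≤ n ⦃ >-nonZero (≤-trans (s≤s z≤n) 2≤n) ⦄ (*-monoʳ-≤ 2 (*-monoʳ-≤ 260 M≤2n)) ⟩
  n ^ (2 * (260 * (2 * n)))      ≡⟨ cong (n ^_) (e₂ n) ⟩
  n ^ (1040 * n)                 ∎
  where
  open ≤-Reasoning
  M = 2 ^ k
  e₁ : ∀ k m → 2 * (2 * (65 * (k * m))) ≡ k * (260 * m)
  e₁ = ℕ-Solver.solve-∀
  e₂ : ∀ n → 2 * (260 * (2 * n)) ≡ 1040 * n
  e₂ = ℕ-Solver.solve-∀
  n<2^n : ∀ n → n < 2 ^ n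
  n<2^n zero    = s≤s z≤n
  n<2^n (suc n) = +-mono-≤ (m^n>0 2 n) (≤-trans (n<2^n n) (m≤m+n (2 ^ n) 0))

-- For `n` at most 1 the bound equals 1, so `H` has to serve as its own host.
edgeless-ramsey : ∀ {n} (H : Graph n) → (∀ i j → adj H i j ≡ false) → IndRamseyFor H H
edgeless-ramsey H none κ = record { emb = λ i → i ; embInj = λ e → e ; embInduced = λ _ _ → refl } , true ,
  λ i j e → ⊥-elim (true≢false (trans (sym e) (none i j)))
  where
  true≢false : true ≢ false
  true≢false ()

-- For positive `n`, `n ^ (c * n)` is 2^(c n log n) written without logarithms; for `n` equal to 0
-- it is 1.
theorem1p2 : ∃[ c ] (∀ (n : ℕ) (H : Graph n) → IndRamseyAtMost H (n ^ (c * n)))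
theorem1p2 = 1040 , bound
  where
  bound : ∀ (n : ℕ) (H : Graph n) → IndRamseyAtMost H (n ^ (1040 * n))
  bound zero H = 0 , z≤n , H , edgeless-ramsey H λ ()
  bound (suc zero) H = 1 , ≤-reflexive (sym (^-zeroˡ (1040 * 1))) , H , edgeless-ramsey H λ { zero zero → irrefl H zero }
  bound n@(suc (suc _)) H with dyadic n (s≤s z≤n)
  ... | zero  , n≤1 , _  = ⊥-elim (<⇒≱ (s≤s (s≤s z≤n)) n≤1)
  ... | suc k , n≤M , M≤2n = 4 ^ (2 * rank (suc k) (2 ^ suc k)) , symplectic-order≤ n (s≤s (s≤s z≤n)) (suc k) (s≤s z≤n) M≤2n ,
    symplectic (2 * rank (suc k) (2 ^ suc k)) , symplectic-ramsey (suc k) H n≤M
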